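{- For every closed pPCF term $M$ of type $\mathrm{nat}$ and every $n\in\mathbb N$, $$[\![M:\mathrm{nat}]\!]_n=\mathrm{Prob}^\infty_{M,\underline n}.$$
   Context: Syntax of pPCF. Types: $t,u::=\mathrm{nat}\mid t\to u$. Terms: $M,N,\dots::=\underline n\mid x\mid \mathrm{succ}(M)\mid \mathrm{if}(M,P,z\cdot Q)\mid\lambda x^t.M\mid (M)N\mid\mathrm{coin}(\kappa)\mid\mathrm{fix}(M)$, with $n\in\mathbb N$, $x$ a variable, $\kappa\in[0,1]\cap\mathbb Q$ (the variable $z$ is bound in $Q$). Typing: $\Gamma,x:t\vdash x:t$; if $\Gamma,x:t\vdash M:u$ then $\Gamma\vdash\lambda x^t.M:t\to u$; if $\Gamma\vdash M:t\to u$ and $\Gamma\vdash N:t$ then $\Gamma\vdash(M)N:u$; if $\Gamma\vdash M:t\to t$ then $\Gamma\vdash\mathrm{fix}(M):t$; $\Gamma\vdash\underline n:\mathrm{nat}$; if $\Gamma\vdash M:\mathrm{nat}$ then $\Gamma\vdash\mathrm{succ}(M):\mathrm{nat}$; $\Gamma\vdash\mathrm{coin}(\kappa):\mathrm{nat}$; if $\Gamma\vdash M:\mathrm{nat}$, $\Gamma\vdash P:t$ and $\Gamma,z:\mathrm{nat}\vdash Q:t$ then $\Gamma\vdash\mathrm{if}(M,P,z\cdot Q):t$. Reduction $M\xrightarrow{\kappa}M'$ (one step with probability $\kappa$; $\to_d$ means $\xrightarrow{1}$): $\mathrm{coin}(\kappa)\xrightarrow{\kappa}\underline 0$; $\mathrm{coin}(\kappa)\xrightarrow{1-\kappa}\underline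 1$; $\mathrm{fix}(M)\to_d(M)\mathrm{fix}(M)$; $\mathrm{succ}(\underline n)\to_d\underline{n+1}$; $(\lambda x^t.M)N\to_d M[x\mapsto N]$; $\mathrm{if}(\underline 0,P,z\cdot Q)\to_d P$; $\mathrm{if}(\underline{n+1},P,z\cdot Q)\to_d Q[z\mapsto\underline n]$; and if $M\xrightarrow{\kappa}N$ then $\mathrm{succ}(M)\xrightarrow{\kappa}\mathrm{succ}(N)$, $(M)P\xrightarrow{\kappa}(N)P$ and $\mathrm{if}(M,P,z\cdot Q)\xrightarrow{\kappa}\mathrm{if}(N,P,z\cdot Q)$. A term is weak-normal if it admits no reduction $M\xrightarrow{\kappa}M'$. Matrix: with $\Lambda$ the set of all pPCF terms, $\mathrm{Prob}\in[0,1]^{\Lambda\times\Lambda}$ is given by $\mathrm{Prob}_{M,M'}=\kappa$ if $M\xrightarrow{\kappa}M'$, $\mathrm{Prob}_{M,M'}=1$ if $M=M'$ is weak-normal, and $0$ otherwise. $\mathrm{Prob}^k$ is its $k$-th power, so $\mathrm{Prob}^k_{M,M'}$ is the probability that $M$ reduces to $M'$ in $k$ steps, and $\mathrm{Prob}^\infty_{M,\underline n}:=\sup_k\mathrm{Prob}^k_{M,\underline n}$. Semantics. $[\![\mathrm{nat}]\!]=\{\varphi:\mathbb N\to[0,1]\mid\sum_n\varphi(n)\le1\}$ with pointwise order and pointwise (sub)convex sums; elements are written as sequences. $[\![t\to u]\!]$ is the set of Scott-continuous maps $[\![t]\!]\to[\![u]\!]$ with pointwise order and pointwise (sub)convex sums.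 For $\Gamma=(x_1:t_1,\dots,x_n:t_n)$, $[\![\Gamma]\!]=[\![t_1]\!]\times\cdots\times[\![t_n]\!]$, and $[\![\Gamma\vdash M:t]\!]:[\![\Gamma]\!]\to[\![t]\!]$ is the Scott-continuous map defined as follows, where $e_i$ is the sequence with $1$ at $i$ and $0$ elsewhere, and countable sums are suprema of finite partial sums: $[\![x_i]\!](\rho)=\rho_i$; $[\![\underline n]\!](\rho)=e_n$; $[\![\mathrm{coin}(\kappa)]\!](\rho)=\kappa\cdot e_0+(1-\kappa)\cdot e_1$; $[\![\mathrm{succ}(M)]\!](\rho)=(0,u_0,u_1,\dots)$ with $u=[\![M]\!](\rho)$; $[\![\mathrm{if}(M,P,z\cdot Q)]\!](\rho)=v_0u+\sum_{i\ge1}v_iu'_i$ with $v=[\![M]\!](\rho)$, $u=[\![P]\!](\rho)$, $u'_i=[\![\Gamma,z:\mathrm{nat}\vdash Q:t]\!](\rho,e_{i-1})$; $[\![\mathrm{fix}(M)]\!](\rho)=\bigvee_n f^n(\perp)$ with $f=[\![M]\!](\rho)$; $[\![(M)N]\!](\rho)=[\![M]\!](\rho)([\![N]\!](\rho))$; $[\![\lambda x^u.M]\!](\rho)(x)=[\![\Gamma,x:u\vdash M:t]\!](\rho,x)$. For closed $\vdash M:\mathrm{nat}$, $[\![M:\mathrm{nat}]\!]_n$ denotes the $n$-th entry of $[\![\vdash M:\mathrm{nat}]\!]\in[\![\mathrm{nat}]\!]$. -}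

module Defs where

open import Data.Bool using (if_then_else_)
open import Data.List using (List; []; _∷_; _++_; map; foldr)
open import Data.List.Membership.Propositional using (_∈_; find; lose)
open import Data.List.Membership.Propositional.Properties using (∈-map⁺; ∈-++⁺ˡ; ∈-++⁺ʳ)
open import Data.List.Relation.Unary.All using (All; []; _∷_; lookup)
open import Data.List.Relation.Unary.All.Properties using (++⁺)
open import Data.List.Relation.Unary.Any using (here; there; any?)
open import Data.List.Relation.Unary.Unique.Propositional using (Unique; [])
open import Data.Nat using (ℕ; zero; suc; _≡ᵇ_) renaming (_≟_ to _≟ℕ_)
import Data.Nat as ℕ
import Data.Nat.Properties as ℕₚ
open import Data.Product using (Σ; ∃; ∃₂; _×_; _,_; proj₁; proj₂; map₂)
open import Data.Rational as ℚ using (ℚ; 0ℚ; 1ℚ)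
import Data.Rational.Properties as ℚₚ
open import Data.Sum using (inj₁; inj₂; [_,_]′)
open import Data.Unit.Polymorphic using (⊤; tt)
open import Function using (_∘_; id; const)
open import Level using (0ℓ; Lift; lift; lower) renaming (suc to lsuc)
open import Relation.Binary using (Poset; Reflexive; Transitive; DecidableEquality)
import Relation.Binary.Construct.Interior.Symmetric as Symmetric
open import Relation.Binary.PropositionalEquality
  using (_≡_; refl; sym; trans; cong; subst; subst₂)
open import Relation.Nullary using (¬_; Dec; yes; no; does)
open import Relation.Nullary.Decidable using (map′; _×-dec_; recompute; from-yes)

record ℚ𝕀 : Set where
  constructor mkℚ𝕀
  field
    value  : ℚ
    .lower-bound : 0ℚ ℚ.≤ value
    .upper-bound : value ℚ.≤ 1ℚ

open ℚ𝕀 public using (value)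

_≟ℚ𝕀_ : DecidableEquality ℚ𝕀
mkℚ𝕀 p _ _ ≟ℚ𝕀 mkℚ𝕀 q _ _ = map′ (λ { refl → refl }) (cong value) (p ℚ.≟ q)

0≤value : ∀ κ → 0ℚ ℚ.≤ value κ
0≤value (mkℚ𝕀 p 0≤p _) = recompute (0ℚ ℚ.≤? p) 0≤p

value≤1 : ∀ κ → value κ ℚ.≤ 1ℚ
value≤1 (mkℚ𝕀 p _ p≤1) = recompute (p ℚ.≤? 1ℚ) p≤1

1𝕀 : ℚ𝕀
1𝕀 = mkℚ𝕀 1ℚ (from-yes (0ℚ ℚ.≤? 1ℚ)) ℚₚ.≤-refl

private
  0≤1-p : ∀ {p} → p ℚ.≤ 1ℚ → 0ℚ ℚ.≤ 1ℚ ℚ.- p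
  0≤1-p {p} p≤1 =
    subst (ℚ._≤ 1ℚ ℚ.- p) (ℚₚ.+-inverseʳ p) (ℚₚ.+-monoˡ-≤ (ℚ.- p) p≤1)

  1-p≤1 : ∀ {p} → 0ℚ ℚ.≤ p → 1ℚ ℚ.- p ℚ.≤ 1ℚ
  1-p≤1 {p} 0≤p =
    subst (1ℚ ℚ.- p ℚ.≤_) (ℚₚ.+-identityʳ 1ℚ) (ℚₚ.+-monoʳ-≤ 1ℚ (ℚₚ.neg-antimono-≤ 0≤p))

1-_ : ℚ𝕀 → ℚ𝕀
1- mkℚ𝕀 p 0≤p p≤1 = mkℚ𝕀 (1ℚ ℚ.- p) (0≤1-p p≤1) (1-p≤1 0≤p)

-- A non-negative extended real x is given by its lower Dedekind cut
-- { q ∈ ℚ | q < x }.  Suprema of arbitrary inhabited families exist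
-- constructively for lower cuts, which is not the case for Cauchy or
-- two-sided Dedekind reals; classically lower cuts of this kind are exactly
-- the elements of [0,∞].  The unit interval [0,1] is the part below 1ℝ; sums
-- are computed in the whole of [0,∞].
--
-- Here and below, records without η and with inlined constructors keep
-- compound objects such as x + y folded, so that implicit arguments are inferred.

infix 4 _∋_ _≤_ _≈_
infixl 6 _+_
infixl 7 _*_

record ℝ⁺ : Set₁ where
  no-eta-equality
  constructor mkℝ⁺
  field
    cut      : ℚ → Set
    negative : ∀ {q} → q ℚ.< 0ℚ → cut q
    downward : ∀ {p q} → p ℚ.≤ q → cut q → cut p
    rounded  : ∀ {q} → cut q → ∃ λ r → q ℚ.< r × cut r

{-# INLINE mkℝ⁺ #-}

open ℝ⁺ public

_∋_ : ℝ⁺ → ℚ → Set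
x ∋ q = cut x q

record _≤_ (x y : ℝ⁺) : Set where
  constructor mk≤
  field at : ∀ {q} → x ∋ q → y ∋ q

open _≤_ public

≤-refl : Reflexive _≤_
≤-refl = mk≤ id

≤-trans : Transitive _≤_
≤-trans x≤y y≤z = mk≤ (at y≤z ∘ at x≤y)

-- Equality of reals: the two cuts have the same elements.
_≈_ : ℝ⁺ → ℝ⁺ → Set
_≈_ = Symmetric.SymInterior _≤_

fromℚ𝕀 : ℚ𝕀 → ℝ⁺
fromℚ𝕀 κ = record
  { cut      = ℚ._< value κ
  ; negative = λ q<0 → ℚₚ.<-≤-trans q<0 (0≤value κ)
  ; downward = ℚₚ.≤-<-trans
  ; rounded  = λ q<κ → let (r , q<r , r<κ) = ℚₚ.<-dense q<κ in r , q<r , r<κ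
  }

0ℝ 1ℝ : ℝ⁺
0ℝ = fromℚ𝕀 (1- 1𝕀)
1ℝ = fromℚ𝕀 1𝕀

private
  half : ∀ q → q ℚ.≤ ℚ.½ ℚ.* q ℚ.+ ℚ.½ ℚ.* q
  half q = ℚₚ.≤-reflexive
    (sym (trans (sym (ℚₚ.*-distribʳ-+ q ℚ.½ ℚ.½)) (ℚₚ.*-identityˡ q)))

  half<0 : ∀ {q} → q ℚ.< 0ℚ → ℚ.½ ℚ.* q ℚ.< 0ℚ
  half<0 {q} q<0 =
    subst (ℚ.½ ℚ.* q ℚ.<_) (ℚₚ.*-zeroʳ ℚ.½) (ℚₚ.*-monoʳ-<-pos ℚ.½ q<0)

  pos : ℚ → ℚ
  pos p = 0ℚ ℚ.⊔ p

  pos≥0 : ∀ p → 0ℚ ℚ.≤ pos p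
  pos≥0 p = ℚₚ.p≤p⊔q 0ℚ p

  pos≥ : ∀ p → p ℚ.≤ pos p
  pos≥ p = ℚₚ.p≤q⊔p 0ℚ p

  pos-mono : ∀ {p q} → p ℚ.≤ q → pos p ℚ.≤ pos q
  pos-mono = ℚₚ.⊔-monoʳ-≤ 0ℚ

  pos-of-neg : ∀ {p} → p ℚ.≤ 0ℚ → pos p ≡ 0ℚ
  pos-of-neg = ℚₚ.p≥q⇒p⊔q≡p

  pos-of-pos : ∀ {p} → 0ℚ ℚ.≤ p → pos p ≡ p
  pos-of-pos = ℚₚ.p≤q⇒p⊔q≡q

  *-mono-ℚ : ∀ {a b c d} → 0ℚ ℚ.≤ b → 0ℚ ℚ.≤ c → a ℚ.≤ b → c ℚ.≤ d → a ℚ.* c ℚ.≤ b ℚ.* d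
  *-mono-ℚ {b = b} {c = c} 0≤b 0≤c a≤b c≤d =
    ℚₚ.≤-trans (ℚₚ.*-monoʳ-≤-nonNeg c {{ℚ.nonNegative 0≤c}} a≤b)
               (ℚₚ.*-monoˡ-≤-nonNeg b {{ℚ.nonNegative 0≤b}} c≤d)

  pos*pos≥0 : ∀ a b → 0ℚ ℚ.≤ pos a ℚ.* pos b
  pos*pos≥0 a b = *-mono-ℚ {a = 0ℚ} {c = 0ℚ} (pos≥0 a) ℚₚ.≤-refl (pos≥0 a) (pos≥0 b)

_+_ : ℝ⁺ → ℝ⁺ → ℝ⁺
x + y = record
  { cut      = λ q → ∃₂ λ a b → x ∋ a × y ∋ b × q ℚ.≤ a ℚ.+ b
  ; negative = λ {q} q<0 → ℚ.½ ℚ.* q , ℚ.½ ℚ.* q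
             , negative x (half<0 q<0) , negative y (half<0 q<0) , half q
  ; downward = λ p≤q (a , b , xa , yb , q≤) → a , b , xa , yb , ℚₚ.≤-trans p≤q q≤
  ; rounded  = λ (a , b , xa , yb , q≤) →
      let (a′ , a<a′ , xa′) = rounded x xa in
      a′ ℚ.+ b , ℚₚ.≤-<-trans q≤ (ℚₚ.+-monoˡ-< b a<a′) , a′ , b , xa′ , yb , ℚₚ.≤-refl
  }

-- The positive parts make the product of two cuts containing negative
-- rationals correct without a case distinction on signs.
_*_ : ℝ⁺ → ℝ⁺ → ℝ⁺
x * y = record
  { cut      = λ q → ∃₂ λ a b → x ∋ a × y ∋ b × q ℚ.< (0ℚ ℚ.⊔ a) ℚ.* (0ℚ ℚ.⊔ b)
  ; negative = λ {q} q<0 → q , q , negative x q<0 , negative y q<0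
             , ℚₚ.<-≤-trans q<0 (pos*pos≥0 q q)
  ; downward = λ p≤q (a , b , xa , yb , q<) → a , b , xa , yb , ℚₚ.≤-<-trans p≤q q<
  ; rounded  = λ (a , b , xa , yb , q<) →
      let (r , q<r , r<) = ℚₚ.<-dense q< in r , q<r , a , b , xa , yb , r<
  }

-- Supremum of a family; the first argument witnesses that the index is inhabited.
sup : {I : Set} → I → (I → ℝ⁺) → ℝ⁺
sup i₀ x = record
  { cut      = λ q → ∃ λ i → x i ∋ q
  ; negative = λ q<0 → i₀ , negative (x i₀) q<0
  ; downward = λ p≤q (i , xq) → i , downward (x i) p≤q xq
  ; rounded  = λ (i , xq) → let (r , q<r , xr) = rounded (x i) xq in r , q<r , i , xr
  }

-- ∑< k f is f 0 + ⋯ + f (k - 1).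
∑< : ℕ → (ℕ → ℝ⁺) → ℝ⁺
∑< zero    f = 0ℝ
∑< (suc k) f = f 0 + ∑< k (f ∘ suc)

sup-upper : ∀ {I : Set} {i₀ : I} (x : I → ℝ⁺) i → x i ≤ sup i₀ x
sup-upper x i = mk≤ (i ,_)

sup-least : ∀ {I : Set} {i₀ : I} (x : I → ℝ⁺) {y} → (∀ i → x i ≤ y) → sup i₀ x ≤ y
sup-least x x≤y = mk≤ λ (i , xq) → at (x≤y i) xq

0≤ : ∀ x → 0ℝ ≤ x
0≤ x = mk≤ (negative x)

+-mono : ∀ {x x′ y y′} → x ≤ x′ → y ≤ y′ → x + y ≤ x′ + y′
+-mono x≤ y≤ = mk≤ λ (a , b , xa , yb , q≤) → a , b , at x≤ xa , at y≤ yb , q≤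

*-mono : ∀ {x x′ y y′} → x ≤ x′ → y ≤ y′ → x * y ≤ x′ * y′
*-mono x≤ y≤ = mk≤ λ (a , b , xa , yb , q<) → a , b , at x≤ xa , at y≤ yb , q<

+-comm : ∀ x y → x + y ≤ y + x
+-comm x y = mk≤ λ (a , b , xa , yb , q≤) →
  b , a , yb , xa , ℚₚ.≤-trans q≤ (ℚₚ.≤-reflexive (ℚₚ.+-comm a b))

+-assocʳ : ∀ x y z → (x + y) + z ≤ x + (y + z)
+-assocʳ x y z = mk≤ λ (d , c , (a , b , xa , yb , d≤) , zc , q≤) →
  a , b ℚ.+ c , xa , (b , c , yb , zc , ℚₚ.≤-refl)
  , ℚₚ.≤-trans q≤ (ℚₚ.≤-trans (ℚₚ.+-monoˡ-≤ c d≤) (ℚₚ.≤-reflexive (ℚₚ.+-assoc a b c)))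

+-assocˡ : ∀ x y z → x + (y + z) ≤ (x + y) + z
+-assocˡ x y z = mk≤ λ (a , d , xa , (b , c , yb , zc , d≤) , q≤) →
  a ℚ.+ b , c , (a , b , xa , yb , ℚₚ.≤-refl) , zc
  , ℚₚ.≤-trans q≤ (ℚₚ.≤-trans (ℚₚ.+-monoʳ-≤ a d≤) (ℚₚ.≤-reflexive (sym (ℚₚ.+-assoc a b c))))

+-identityˡ-≤ : ∀ {x y} → x ≤ 0ℝ → x + y ≤ y
+-identityˡ-≤ {x} {y} x≤0 = mk≤ λ (a , b , xa , yb , q≤) →
  downward y (ℚₚ.≤-trans q≤ (ℚₚ.≤-trans (ℚₚ.+-monoˡ-≤ b (ℚₚ.<⇒≤ (at x≤0 xa)))
                              (ℚₚ.≤-reflexive (ℚₚ.+-identityˡ b)))) yb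

≤-+ʳ : ∀ x y → y ≤ x + y
≤-+ʳ x y = mk≤ λ {q} yq →
  let (r , q<r , yr) = rounded y yq
      q-r = q ℚ.- r
      q-r<0 = subst (q-r ℚ.<_) (ℚₚ.+-inverseʳ r) (ℚₚ.+-monoˡ-< (ℚ.- r) q<r)
      q≡ = trans (ℚₚ.+-assoc q (ℚ.- r) r)
             (trans (cong (q ℚ.+_) (ℚₚ.+-inverseˡ r)) (ℚₚ.+-identityʳ q))
  in q-r , r , negative x q-r<0 , yr , ℚₚ.≤-reflexive (sym q≡)

≤-+ˡ : ∀ x y → x ≤ x + y
≤-+ˡ x y = ≤-trans (≤-+ʳ y x) (+-comm y x)

+-interchange : ∀ a b c d → (a + b) + (c + d) ≤ (a + c) + (b + d)
+-interchange a b c d =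
  ≤-trans (+-assocʳ a b (c + d))
  (≤-trans (+-mono ≤-refl
             (≤-trans (+-assocˡ b c d)
             (≤-trans (+-mono (+-comm b c) ≤-refl) (+-assocʳ c b d))))
           (+-assocˡ a c (b + d)))

*-distrib-≤ : ∀ x y z → x * y + x * z ≤ x * (y + z)
*-distrib-≤ x y z = mk≤ λ {q} (c , d , (a , b , xa , yb , c<) , (a′ , b′ , xa′ , zb′ , d<) , q≤) →
  let m = a ℚ.⊔ a′
      xm = [ (λ e → subst (x ∋_) (sym e) xa) , (λ e → subst (x ∋_) (sym e) xa′) ]′
             (ℚₚ.⊔-sel a a′)
      c<′ = ℚₚ.<-≤-trans c< (*-mono-ℚ (pos≥0 m) (pos≥0 b) (pos-mono (ℚₚ.p≤p⊔q a a′)) ℚₚ.≤-refl)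
      d<′ = ℚₚ.<-≤-trans d< (*-mono-ℚ (pos≥0 m) (pos≥0 b′) (pos-mono (ℚₚ.p≤q⊔p a a′)) ℚₚ.≤-refl)
      q<  = subst (q ℚ.<_) (sym (ℚₚ.*-distribˡ-+ (pos m) (pos b) (pos b′)))
              (ℚₚ.≤-<-trans q≤ (ℚₚ.+-mono-< c<′ d<′))
      (e , ye , b+b′≤e) = combine yb zb′
  in m , e , xm , ye
   , ℚₚ.<-≤-trans q< (*-mono-ℚ (pos≥0 m) (ℚₚ.+-mono-≤ (pos≥0 b) (pos≥0 b′)) ℚₚ.≤-refl b+b′≤e)
  where
  combine : ∀ {b b′} → y ∋ b → z ∋ b′ →
            ∃ λ e → (y + z) ∋ e × pos b ℚ.+ pos b′ ℚ.≤ pos e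
  combine {b} {b′} yb zb′ with ℚₚ.≤-total 0ℚ b | ℚₚ.≤-total 0ℚ b′
  ... | inj₁ 0≤b | inj₁ 0≤b′ = b ℚ.+ b′ , (b , b′ , yb , zb′ , ℚₚ.≤-refl)
      , subst₂ (λ u v → u ℚ.+ v ℚ.≤ pos (b ℚ.+ b′)) (sym (pos-of-pos 0≤b)) (sym (pos-of-pos 0≤b′))
          (pos≥ (b ℚ.+ b′))
  ... | _ | inj₂ b′≤0 = b , at (≤-+ˡ y z) yb
      , ℚₚ.≤-reflexive (trans (cong (pos b ℚ.+_) (pos-of-neg b′≤0)) (ℚₚ.+-identityʳ (pos b)))
  ... | inj₂ b≤0 | _ = b′ , at (≤-+ʳ y z) zb′
      , ℚₚ.≤-reflexive (trans (cong (ℚ._+ pos b′) (pos-of-neg b≤0)) (ℚₚ.+-identityˡ (pos b′)))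

*-identityʳ-≤ : ∀ {x y} → y ≤ 1ℝ → x * y ≤ x
*-identityʳ-≤ {x} {y} y≤1 = mk≤ λ {q} (a , b , xa , yb , q<) →
  let pos-b≤1 = ℚₚ.⊔-lub (0≤value 1𝕀) (ℚₚ.<⇒≤ (at y≤1 yb))
      q<pos-a = ℚₚ.<-≤-trans q<
        (subst (pos a ℚ.* pos b ℚ.≤_) (ℚₚ.*-identityʳ (pos a))
          (*-mono-ℚ (pos≥0 a) (pos≥0 b) ℚₚ.≤-refl pos-b≤1))
  in [ (λ e → negative x (subst (q ℚ.<_) e q<pos-a))
     , (λ e → downward x (ℚₚ.<⇒≤ (subst (q ℚ.<_) e q<pos-a)) xa) ]′
       (ℚₚ.⊔-sel 0ℚ a)

∑<-mono : ∀ k {f g : ℕ → ℝ⁺} → (∀ i → f i ≤ g i) → ∑< k f ≤ ∑< k g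
∑<-mono zero    f≤g = ≤-refl
∑<-mono (suc k) f≤g = +-mono (f≤g 0) (∑<-mono k (f≤g ∘ suc))

∑<-grow : ∀ k (f : ℕ → ℝ⁺) → ∑< k f ≤ ∑< (suc k) f
∑<-grow zero    f = 0≤ _
∑<-grow (suc k) f = +-mono ≤-refl (∑<-grow k (f ∘ suc))

∑<-zero : ∀ k → ∑< k (const 0ℝ) ≤ 0ℝ
∑<-zero zero    = ≤-refl
∑<-zero (suc k) = ≤-trans (+-identityˡ-≤ ≤-refl) (∑<-zero k)

∑<-+ : ∀ k (f g : ℕ → ℝ⁺) → ∑< k (λ i → f i + g i) ≤ ∑< k f + ∑< k g
∑<-+ zero    f g = 0≤ _
∑<-+ (suc k) f g =
  ≤-trans (+-mono ≤-refl (∑<-+ k (f ∘ suc) (g ∘ suc))) (+-interchange (f 0) (g 0) _ _)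

∑<-* : ∀ k x (f : ℕ → ℝ⁺) → ∑< k (λ i → x * f i) ≤ x * ∑< k f
∑<-* zero    x f = 0≤ _
∑<-* (suc k) x f =
  ≤-trans (+-mono ≤-refl (∑<-* k x (f ∘ suc))) (*-distrib-≤ x (f 0) (∑< k (f ∘ suc)))

∑<-swap : ∀ k n (f : ℕ → ℕ → ℝ⁺) →
          ∑< k (λ m → ∑< n (λ i → f i m)) ≤ ∑< n (λ i → ∑< k (f i))
∑<-swap k zero    f = ∑<-zero k
∑<-swap k (suc n) f =
  ≤-trans (∑<-+ k (f 0) (λ m → ∑< n (λ i → f (suc i) m)))
          (+-mono ≤-refl (∑<-swap k n (f ∘ suc)))

Jointly-directed : {I : Set} (x y : I → ℝ⁺) → Set
Jointly-directed {I} x y = ∀ i j → ∃ λ k → x i ≤ x k × y j ≤ y k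

sup-+ : ∀ {I : Set} {i₀ : I} (x y : I → ℝ⁺) → Jointly-directed x y →
        sup i₀ x + sup i₀ y ≤ sup i₀ (λ i → x i + y i)
sup-+ x y dir = mk≤ λ (a , b , (i , xa) , (j , yb) , q≤) →
  let (k , x≤ , y≤) = dir i j in k , a , b , at x≤ xa , at y≤ yb , q≤

sup-* : ∀ {I : Set} {i₀ : I} (x y : I → ℝ⁺) → Jointly-directed x y →
        sup i₀ x * sup i₀ y ≤ sup i₀ (λ i → x i * y i)
sup-* x y dir = mk≤ λ (a , b , (i , xa) , (j , yb) , q<) →
  let (k , x≤ , y≤) = dir i j in k , a , b , at x≤ xa , at y≤ yb , q<

∑<-sup : ∀ {I : Set} {i₀ : I} k (f : I → ℕ → ℝ⁺) →
         (∀ i j → ∃ λ l → (∀ n → f i n ≤ f l n) × (∀ n → f j n ≤ f l n)) →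
         ∑< k (λ n → sup i₀ (λ i → f i n)) ≤ sup i₀ (λ i → ∑< k (f i))
∑<-sup {i₀ = i₀} zero    f dir = 0≤ _
∑<-sup {i₀ = i₀} (suc k) f dir =
  ≤-trans (+-mono ≤-refl (∑<-sup k (λ i → f i ∘ suc)
            (λ i j → let (l , p , q) = dir i j in l , p ∘ suc , q ∘ suc)))
          (sup-+ (λ i → f i 0) (λ i → ∑< k (f i ∘ suc))
            (λ i j → let (l , p , q) = dir i j in l , p 0 , ∑<-mono k (q ∘ suc)))

-- Two elements are identified (_≈_) when each is below the other.  Directed
-- families are indexed by types in Set while carriers live in Set₁, as usual
-- for predicative domain theory.

record Directed {A : Set₁} (_⊑_ : A → A → Set₁) {I : Set} (α : I → A) : Set₁ where
  constructor directed
  field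
    element : I
    bound   : ∀ i j → ∃ λ k → α i ⊑ α k × α j ⊑ α k

open Directed public

record DCPO : Set₂ where
  no-eta-equality
  constructor mkDCPO
  field
    poset : Poset (lsuc 0ℓ) (lsuc 0ℓ) (lsuc 0ℓ)

  open Poset poset public using (Carrier)
    renaming (_≤_ to _⊑_; refl to ⊑-refl; trans to ⊑-trans)

  field
    ⨆       : {I : Set} (α : I → Carrier) → Directed _⊑_ α → Carrier
    ⨆-upper : ∀ {I : Set} (α : I → Carrier) (d : Directed _⊑_ α) i → α i ⊑ ⨆ α d
    ⨆-least : ∀ {I : Set} (α : I → Carrier) (d : Directed _⊑_ α) {y} →
              (∀ i → α i ⊑ y) → ⨆ α d ⊑ y

  ⨆-mono : ∀ {I : Set} {α β : I → Carrier} (d : Directed _⊑_ α) (e : Directed _⊑_ β) →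
           (∀ i → α i ⊑ β i) → ⨆ α d ⊑ ⨆ β e
  ⨆-mono {β = β} d e α⊑β = ⨆-least _ d λ i → ⊑-trans (α⊑β i) (⨆-upper β e i)

{-# INLINE mkDCPO #-}

∣_∣ : DCPO → Set₁
∣ D ∣ = DCPO.Carrier D

record _⟶_ (D E : DCPO) : Set₁ where
  no-eta-equality
  constructor mk⟶
  private
    module D = DCPO D
    module E = DCPO E
  field
    fun  : D.Carrier → E.Carrier
    mono : ∀ {x y} → x D.⊑ y → fun x E.⊑ fun y

  image-directed : ∀ {I : Set} {α : I → D.Carrier} → Directed D._⊑_ α → Directed E._⊑_ (fun ∘ α)
  image-directed d = directed (element d) λ i j →
    let (k , p , q) = bound d i j in k , mono p , mono q

  -- The converse inequality is a consequence of monotonicity.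
  field
    continuous : ∀ {I : Set} (α : I → D.Carrier) (d : Directed D._⊑_ α) →
                 fun (D.⨆ α d) E.⊑ E.⨆ (fun ∘ α) (image-directed d)

{-# INLINE mk⟶ #-}

open _⟶_ public

infix  1 _⟶_
infixl 9 _·_
_·_ : ∀ {D E} → (D ⟶ E) → ∣ D ∣ → ∣ E ∣
f · x = fun f x

infixr 8 _⊚_
_⊚_ : ∀ {C D E} → (D ⟶ E) → (C ⟶ D) → (C ⟶ E)
_⊚_ {C} {D} {E} g f = record
  { fun        = λ x → g · (f · x)
  ; mono       = mono g ∘ mono f
  ; continuous = λ α d → ⊑-trans (mono g (continuous f α d))
      (⊑-trans (continuous g (fun f ∘ α) (image-directed f d)) (⨆-mono _ _ λ _ → ⊑-refl))
  }
  where open DCPO E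

constᶜ : ∀ {D E} → ∣ E ∣ → (D ⟶ E)
constᶜ {D} {E} y = record
  { fun        = const y
  ; mono       = λ _ → ⊑-refl
  ; continuous = λ α d → ⨆-upper (const y) _ (element d)
  }
  where open DCPO E

idᶜ : ∀ {D} → (D ⟶ D)
idᶜ {D} = record
  { fun        = id
  ; mono       = id
  ; continuous = λ α d → ⨆-mono _ _ λ _ → ⊑-refl
  }
  where open DCPO D

𝟙 : DCPO
𝟙 = record
  { poset   = Symmetric.poset {A = ⊤} {R = λ _ _ → ⊤} tt (λ _ _ → tt)
  ; ⨆       = λ _ _ → tt
  ; ⨆-upper = λ _ _ _ → tt
  ; ⨆-least = λ _ _ _ → tt
  }

infixr 5 _⊗_
_⊗_ : DCPO → DCPO → DCPO
D ⊗ E = record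
  { poset   = Symmetric.poset
      {R = λ (x , y) (x′ , y′) → (x D.⊑ x′) × (y E.⊑ y′)}
      (D.⊑-refl , E.⊑-refl)
      (λ (p , q) (p′ , q′) → D.⊑-trans p p′ , E.⊑-trans q q′)
  ; ⨆       = λ α (directed i₀ b) →
        D.⨆ (proj₁ ∘ α) (directed i₀ λ i j → let (k , p , q) = b i j in k , proj₁ p , proj₁ q)
      , E.⨆ (proj₂ ∘ α) (directed i₀ λ i j → let (k , p , q) = b i j in k , proj₂ p , proj₂ q)
  ; ⨆-upper = λ α d i → D.⨆-upper _ _ i , E.⨆-upper _ _ i
  ; ⨆-least = λ α d α⊑y → D.⨆-least _ _ (proj₁ ∘ α⊑y) , E.⨆-least _ _ (proj₂ ∘ α⊑y)
  }
  where
  module D = DCPO D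
  module E = DCPO E

fstᶜ : ∀ {D E} → (D ⊗ E ⟶ D)
fstᶜ {D} = record
  { fun = proj₁ ; mono = proj₁ ; continuous = λ α d → ⨆-mono _ _ λ _ → ⊑-refl }
  where open DCPO D

sndᶜ : ∀ {D E} → (D ⊗ E ⟶ E)
sndᶜ {E = E} = record
  { fun = proj₂ ; mono = proj₂ ; continuous = λ α d → ⨆-mono _ _ λ _ → ⊑-refl }
  where open DCPO E

⟨_,_⟩ : ∀ {C D E} → (C ⟶ D) → (C ⟶ E) → (C ⟶ D ⊗ E)
⟨_,_⟩ {C} {D} {E} f g = record
  { fun        = λ x → f · x , g · x
  ; mono       = λ p → mono f p , mono g p
  ; continuous = λ α d →
        D.⊑-trans (continuous f α d) (D.⨆-mono _ _ λ _ → D.⊑-refl)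
      , E.⊑-trans (continuous g α d) (E.⨆-mono _ _ λ _ → E.⊑-refl)
  }
  where
  module D = DCPO D
  module E = DCPO E

Seq : DCPO → DCPO
Seq D = record
  { poset   = Symmetric.poset {A = ℕ → ∣ D ∣} {R = λ x y → ∀ i → x i ⊑ y i}
      (λ _ → ⊑-refl) (λ p q i → ⊑-trans (p i) (q i))
  ; ⨆       = λ α (directed i₀ b) n → ⨆ (λ i → α i n)
      (record { element = i₀ ; bound = λ i j → let (k , p , q) = b i j in k , p n , q n })
  ; ⨆-upper = λ α d i n → ⨆-upper _ _ i
  ; ⨆-least = λ α d α⊑y n → ⨆-least _ _ λ i → α⊑y i n
  }
  where open DCPO D

seqᶜ : ∀ {C D} → (ℕ → (C ⟶ D)) → (C ⟶ Seq D)
seqᶜ {C} {D} f = record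
  { fun        = λ x i → f i · x
  ; mono       = λ p i → mono (f i) p
  ; continuous = λ α d i → ⊑-trans (continuous (f i) α d) (⨆-mono _ _ λ _ → ⊑-refl)
  }
  where open DCPO D

_⇒_ : DCPO → DCPO → DCPO
D ⇒ E = record
  { poset   = Symmetric.poset {A = D ⟶ E} {R = λ f g → ∀ x → f · x ⊑ g · x}
      (λ _ → ⊑-refl) (λ p q x → ⊑-trans (p x) (q x))
  ; ⨆       = λ {I} F d →
      let dir : ∀ x → Directed _⊑_ (λ i → F i · x)
          dir x = record
            { element = element d
            ; bound   = λ i j → let (k , p , q) = bound d i j in k , p x , q x }
      in record
        { fun        = λ x → ⨆ (λ i → F i · x) (dir x)
        ; mono       = λ p → ⨆-mono _ _ λ i → mono (F i) p
        ; continuous = λ α e → ⨆-least _ _ λ i → ⊑-trans (continuous (F i) α e)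
            (⨆-mono _ _ λ j → ⨆-upper (λ i → F i · α j) (dir (α j)) i)
        }
  ; ⨆-upper = λ F d i x → ⨆-upper (λ i → F i · x) _ i
  ; ⨆-least = λ F d F⊑g x → ⨆-least _ _ λ i → F⊑g i x
  }
  where open DCPO E

applyᶜ : ∀ {D E} → ((D ⇒ E) ⊗ D ⟶ E)
applyᶜ {D} {E} = record
  { fun        = λ (f , x) → f · x
  ; mono       = λ {(f , _)} (p , q) → ⊑-trans (mono f q) (p _)
  ; continuous = λ α d → ⨆-least _ _ λ i →
      ⊑-trans (continuous (proj₁ (α i)) _ _) (⨆-least _ _ λ j →
        let (k , p , q) = bound d i j in
        ⊑-trans (proj₁ p _) (⊑-trans (mono (proj₁ (α k)) (proj₂ q))
          (⨆-upper (λ k → proj₁ (α k) · proj₂ (α k)) _ k)))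
  }
  where open DCPO E

curryᶜ : ∀ {C D E} → (C ⊗ D ⟶ E) → (C ⟶ D ⇒ E)
curryᶜ {C} {D} {E} f = record
  { fun        = λ ρ → f ⊚ ⟨ constᶜ ρ , idᶜ ⟩
  ; mono       = λ p x → mono f (p , DCPO.⊑-refl D)
  ; continuous = λ α d x →
      let ρx-directed = directed (element d) λ i j →
            let (k , p , q) = bound d i j in
            k , (p , DCPO.⊑-refl D) , (q , DCPO.⊑-refl D)
      in ⊑-trans
           (mono f (DCPO.⨆-mono C _ _ (λ _ → DCPO.⊑-refl C)
                   , DCPO.⨆-upper D (const x) _ (element d)))
           (⊑-trans (continuous f (λ i → α i , x) ρx-directed) (⨆-mono _ _ λ _ → ⊑-refl))
  }
  where open DCPO E

chain-≤ : ∀ D (x : ℕ → ∣ D ∣) → (∀ n → DCPO._⊑_ D (x n) (x (suc n))) →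
          ∀ {m n} → m ℕ.≤′ n → DCPO._⊑_ D (x m) (x n)
chain-≤ D x step ℕ.≤′-refl       = DCPO.⊑-refl D
chain-≤ D x step (ℕ.≤′-step m≤n) = DCPO.⊑-trans D (chain-≤ D x step m≤n) (step _)

chain-directed : ∀ D (x : ℕ → ∣ D ∣) → (∀ n → DCPO._⊑_ D (x n) (x (suc n))) →
                 Directed (DCPO._⊑_ D) x
chain-directed D x step = directed 0 λ i j → i ℕ.⊔ j
  , chain-≤ D x step (ℕₚ.≤⇒≤′ (ℕₚ.m≤m⊔n i j))
  , chain-≤ D x step (ℕₚ.≤⇒≤′ (ℕₚ.m≤n⊔m i j))

-- The bound on all partial sums implies that every entry is at most 1.
record SubDist : Set₁ where
  no-eta-equality
  constructor subdist
  field
    prob : ℕ → ℝ⁺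
    mass : ∀ k → ∑< k prob ≤ 1ℝ

{-# INLINE subdist #-}

open SubDist public

Distr : DCPO
Distr = record
  { poset   = Symmetric.poset {A = SubDist} {R = λ φ ψ → Lift (lsuc 0ℓ) (∀ n → prob φ n ≤ prob ψ n)}
      (lift λ _ → ≤-refl) (λ (lift p) (lift q) → lift λ n → ≤-trans (p n) (q n))
  ; ⨆       = λ φ d → record
      { prob = λ n → sup (element d) (λ i → prob (φ i) n)
      ; mass = λ k → ≤-trans
          (∑<-sup k (λ i → prob (φ i)) λ i j →
            let (l , lift p , lift q) = bound d i j in l , p , q)
          (sup-least _ λ i → mass (φ i) k)
      }
  ; ⨆-upper = λ φ d i → lift λ n → sup-upper (λ i → prob (φ i) n) i
  ; ⨆-least = λ φ d φ⊑ψ → lift λ n → sup-least _ λ i → lower (φ⊑ψ i) n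
  }

zeroᴰ : SubDist
zeroᴰ = subdist (const 0ℝ) (λ k → ≤-trans (∑<-zero k) (0≤ 1ℝ))

-- unit n is 1 at n and 0 elsewhere.
unit : ℕ → ℕ → ℝ⁺
unit n i = if i ≡ᵇ n then 1ℝ else 0ℝ

shift : (ℕ → ℝ⁺) → ℕ → ℝ⁺
shift φ zero    = 0ℝ
shift φ (suc n) = φ n

∑<-shift : ∀ {φ y} → (∀ k → ∑< k φ ≤ y) → ∀ k → ∑< k (shift φ) ≤ y
∑<-shift φ≤ zero    = 0≤ _
∑<-shift φ≤ (suc k) = ≤-trans (+-identityˡ-≤ ≤-refl) (φ≤ k)

∑<-unit : ∀ n k → ∑< k (unit n) ≤ 1ℝ
∑<-unit n       zero    = 0≤ _
∑<-unit zero    (suc k) = ≤-trans (+-comm _ _) (+-identityˡ-≤ (∑<-zero k))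
∑<-unit (suc n) (suc k) = ≤-trans (+-identityˡ-≤ ≤-refl) (∑<-unit n k)

e : ℕ → SubDist
e n = subdist (unit n) (∑<-unit n)

κ+[1-κ]≤1 : ∀ κ → fromℚ𝕀 κ + fromℚ𝕀 (1- κ) ≤ 1ℝ
κ+[1-κ]≤1 κ = mk≤ λ (a , b , a<κ , b<1-κ , q≤) → ℚₚ.≤-<-trans q≤
  (subst (a ℚ.+ b ℚ.<_)
    (trans (ℚₚ.+-comm p (1ℚ ℚ.- p))
    (trans (ℚₚ.+-assoc 1ℚ (ℚ.- p) p)
    (trans (cong (1ℚ ℚ.+_) (ℚₚ.+-inverseˡ p)) (ℚₚ.+-identityʳ 1ℚ))))
    (ℚₚ.+-mono-< a<κ b<1-κ))
  where p = value κ

coinᴰ : ℚ𝕀 → SubDist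
coinᴰ κ = subdist (λ n → fromℚ𝕀 κ * prob (e 0) n + fromℚ𝕀 (1- κ) * prob (e 1) n) λ k →
  ≤-trans (∑<-+ k _ _)
  (≤-trans (+-mono (≤-trans (∑<-* k _ _) (*-identityʳ-≤ (mass (e 0) k)))
                   (≤-trans (∑<-* k _ _) (*-identityʳ-≤ (mass (e 1) k))))
           (κ+[1-κ]≤1 κ))

succᶜ : Distr ⟶ Distr
succᶜ = record
  { fun        = λ φ → subdist (shift (prob φ)) (∑<-shift (mass φ))
  ; mono       = λ (lift p) → lift λ { zero → ≤-refl ; (suc n) → p n }
  ; continuous = λ α d → lift λ { zero → 0≤ _ ; (suc n) → ≤-refl }
  }

record Domain : Set₂ where
  no-eta-equality
  constructor mkDomain
  field
    dcpo : DCPO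
  open DCPO dcpo public
  field
    ⊥ᴰ       : Carrier
    ⊥-least  : ∀ x → ⊥ᴰ ⊑ x
    -- partial n · (v , x) is v₀x₀ + ⋯ + vₙ₋₁xₙ₋₁
    partial      : ℕ → (Distr ⊗ Seq dcpo ⟶ dcpo)
    partial-grow : ∀ n v → partial n · v ⊑ partial (suc n) · v

  -- v₀x₀ + v₁x₁ + ⋯, the supremum of the partial sums
  countable-sum : Distr ⊗ Seq dcpo ⟶ dcpo
  countable-sum = DCPO.⨆ ((Distr ⊗ Seq dcpo) ⇒ dcpo) partial
    (chain-directed ((Distr ⊗ Seq dcpo) ⇒ dcpo) partial partial-grow)

  -- iterate n · f is fⁿ(⊥)
  iterate : ℕ → (dcpo ⇒ dcpo ⟶ dcpo)
  iterate zero    = constᶜ ⊥ᴰ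
  iterate (suc n) = applyᶜ ⊚ ⟨ idᶜ , iterate n ⟩

  iterate-grow : ∀ n f → iterate n · f ⊑ iterate (suc n) · f
  iterate-grow zero    f = ⊥-least _
  iterate-grow (suc n) f = mono f (iterate-grow n f)

  fixpoint : (dcpo ⇒ dcpo) ⟶ dcpo
  fixpoint = DCPO.⨆ ((dcpo ⇒ dcpo) ⇒ dcpo) iterate
    (chain-directed ((dcpo ⇒ dcpo) ⇒ dcpo) iterate iterate-grow)

{-# INLINE mkDomain #-}

partialᴰ : ℕ → (Distr ⊗ Seq Distr ⟶ Distr)
partialᴰ n = record
  { fun  = λ (v , φ) → subdist (λ m → ∑< n (λ i → prob v i * prob (φ i) m)) λ k →
      ≤-trans (∑<-swap k n (λ i m → prob v i * prob (φ i) m))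
      (≤-trans (∑<-mono n λ i → ≤-trans (∑<-* k (prob v i) (prob (φ i)))
                                        (*-identityʳ-≤ (mass (φ i) k)))
               (mass v n))
  ; mono = λ (lift p , q) → lift λ m → ∑<-mono n λ i → *-mono (p i) (lower (q i) m)
  ; continuous = λ α d → lift λ m →
      let upper = bound d in
      ≤-trans
        (∑<-mono n λ i → sup-* (λ j → prob (proj₁ (α j)) i) (λ j → prob (proj₂ (α j) i) m)
          λ j j′ → let (l , (lift p , _) , (_ , q)) = upper j j′ in l , p i , lower (q i) m)
        (∑<-sup n (λ j i → prob (proj₁ (α j)) i * prob (proj₂ (α j) i) m) λ j j′ →
          let (l , (lift p , q) , (lift p′ , q′)) = upper j j′ in
          l , (λ i → *-mono (p i) (lower (q i) m)) , (λ i → *-mono (p′ i) (lower (q′ i) m)))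
  }

Natᴰ : Domain
Natᴰ = record
  { dcpo         = Distr
  ; ⊥ᴰ           = zeroᴰ
  ; ⊥-least      = λ φ → lift λ n → 0≤ _
  ; partial      = partialᴰ
  ; partial-grow = λ n (v , φ) → lift λ m → ∑<-grow n (λ i → prob v i * prob (φ i) m)
  }

-- Subconvex sums of functions are pointwise.
_⇒ᴰ_ : Domain → Domain → Domain
D ⇒ᴰ E = record
  { dcpo         = D.dcpo ⇒ E.dcpo
  ; ⊥ᴰ           = constᶜ E.⊥ᴰ
  ; ⊥-least      = λ f x → E.⊥-least _
  ; partial      = λ n → curryᶜ (E.partial n ⊚
      ⟨ fstᶜ ⊚ fstᶜ , seqᶜ (λ i → applyᶜ ⊚ ⟨ atᶜ i ⊚ sndᶜ ⊚ fstᶜ , sndᶜ ⟩) ⟩)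
  ; partial-grow = λ n (v , f) x → E.partial-grow n _
  }
  where
  module D = Domain D
  module E = Domain E
  atᶜ : ∀ {C} → ℕ → (Seq C ⟶ C)
  atᶜ {C} i = record
    { fun        = λ x → x i
    ; mono       = λ p → p i
    ; continuous = λ α d → DCPO.⨆-mono C _ _ λ _ → DCPO.⊑-refl C
    }

-- Terms are raw terms with de Bruijn indices.  In  ifz M P Q  the variable of
-- index 0 is bound in Q.

infixr 7 _⇾_

data Type : Set where
  nat : Type
  _⇾_ : Type → Type → Type

data Term : Set where
  num  : ℕ → Term
  var  : ℕ → Term
  succ : Term → Term
  ifz  : Term → Term → Term → Term
  lam  : Type → Term → Term
  app  : Term → Term → Term
  coin : ℚ𝕀 → Term
  fix  : Term → Term

Context : Set
Context = List Type

data _∋_⦂_ : Context → ℕ → Type → Set where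
  here  : ∀ {Γ t} → (t ∷ Γ) ∋ zero ⦂ t
  there : ∀ {Γ t u i} → Γ ∋ i ⦂ t → (u ∷ Γ) ∋ suc i ⦂ t

infix 3 _⊢_⦂_

data _⊢_⦂_ : Context → Term → Type → Set where
  ⊢var  : ∀ {Γ i t} → Γ ∋ i ⦂ t → Γ ⊢ var i ⦂ t
  ⊢lam  : ∀ {Γ t u M} → t ∷ Γ ⊢ M ⦂ u → Γ ⊢ lam t M ⦂ t ⇾ u
  ⊢app  : ∀ {Γ t u M N} → Γ ⊢ M ⦂ t ⇾ u → Γ ⊢ N ⦂ t → Γ ⊢ app M N ⦂ u
  ⊢fix  : ∀ {Γ t M} → Γ ⊢ M ⦂ t ⇾ t → Γ ⊢ fix M ⦂ t
  ⊢num  : ∀ {Γ n} → Γ ⊢ num n ⦂ nat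
  ⊢succ : ∀ {Γ M} → Γ ⊢ M ⦂ nat → Γ ⊢ succ M ⦂ nat
  ⊢coin : ∀ {Γ κ} → Γ ⊢ coin κ ⦂ nat
  ⊢ifz  : ∀ {Γ t M P Q} → Γ ⊢ M ⦂ nat → Γ ⊢ P ⦂ t → nat ∷ Γ ⊢ Q ⦂ t → Γ ⊢ ifz M P Q ⦂ t

liftʳ : (ℕ → ℕ) → ℕ → ℕ
liftʳ ξ zero    = zero
liftʳ ξ (suc i) = suc (ξ i)

rename : (ℕ → ℕ) → Term → Term
rename ξ (num n)     = num n
rename ξ (var i)     = var (ξ i)
rename ξ (succ M)    = succ (rename ξ M)
rename ξ (ifz M P Q) = ifz (rename ξ M) (rename ξ P) (rename (liftʳ ξ) Q)
rename ξ (lam t M)   = lam t (rename (liftʳ ξ) M)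
rename ξ (app M N)   = app (rename ξ M) (rename ξ N)
rename ξ (coin κ)    = coin κ
rename ξ (fix M)     = fix (rename ξ M)

liftˢ : (ℕ → Term) → ℕ → Term
liftˢ σ zero    = var zero
liftˢ σ (suc i) = rename suc (σ i)

substitute : (ℕ → Term) → Term → Term
substitute σ (num n)     = num n
substitute σ (var i)     = σ i
substitute σ (succ M)    = succ (substitute σ M)
substitute σ (ifz M P Q) = ifz (substitute σ M) (substitute σ P) (substitute (liftˢ σ) Q)
substitute σ (lam t M)   = lam t (substitute (liftˢ σ) M)
substitute σ (app M N)   = app (substitute σ M) (substitute σ N)
substitute σ (coin κ)    = coin κ
substitute σ (fix M)     = fix (substitute σ M)

instantiate : Term → ℕ → Term
instantiate N zero    = N
instantiate N (suc i) = var i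

infix 8 _[_]
_[_] : Term → Term → Term
M [ N ] = substitute (instantiate N) M

infix 2 _—[_]→_

data _—[_]→_ : Term → ℚ𝕀 → Term → Set where
  coin₀  : ∀ {κ} → coin κ —[ κ ]→ num 0
  coin₁  : ∀ {κ} → coin κ —[ 1- κ ]→ num 1
  unfold : ∀ {M} → fix M —[ 1𝕀 ]→ app M (fix M)
  succ-β : ∀ {n} → succ (num n) —[ 1𝕀 ]→ num (suc n)
  lam-β  : ∀ {t M N} → app (lam t M) N —[ 1𝕀 ]→ M [ N ]
  ifz₀   : ∀ {P Q} → ifz (num 0) P Q —[ 1𝕀 ]→ P
  ifz₊   : ∀ {n P Q} → ifz (num (suc n)) P Q —[ 1𝕀 ]→ Q [ num n ]
  succ-ξ : ∀ {κ M N} → M —[ κ ]→ N → succ M —[ κ ]→ succ N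
  app-ξ  : ∀ {κ M N P} → M —[ κ ]→ N → app M P —[ κ ]→ app N P
  ifz-ξ  : ∀ {κ M N P Q} → M —[ κ ]→ N → ifz M P Q —[ κ ]→ ifz N P Q

WeakNormal : Term → Set
WeakNormal M = ∀ κ M′ → ¬ (M —[ κ ]→ M′)

_≟ᵀ_ : DecidableEquality Type
nat     ≟ᵀ nat       = yes refl
nat     ≟ᵀ (_ ⇾ _)   = no λ ()
(_ ⇾ _) ≟ᵀ nat       = no λ ()
(t ⇾ u) ≟ᵀ (t′ ⇾ u′) =
  map′ (λ { (refl , refl) → refl }) (λ { refl → refl , refl }) (t ≟ᵀ t′ ×-dec u ≟ᵀ u′)

private
  tag : Term → ℕ
  tag (num _)     = 0
  tag (var _)     = 1
  tag (succ _)    = 2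
  tag (ifz _ _ _) = 3
  tag (lam _ _)   = 4
  tag (app _ _)   = 5
  tag (coin _)    = 6
  tag (fix _)     = 7

  data Head : ℕ → Term → Set where
    num  : ∀ n → Head 0 (num n)
    var  : ∀ i → Head 1 (var i)
    succ : ∀ M → Head 2 (succ M)
    ifz  : ∀ M P Q → Head 3 (ifz M P Q)
    lam  : ∀ t M → Head 4 (lam t M)
    app  : ∀ M N → Head 5 (app M N)
    coin : ∀ κ → Head 6 (coin κ)
    fix  : ∀ M → Head 7 (fix M)

  head : ∀ M → Head (tag M) M
  head (num n)     = num n
  head (var i)     = var i
  head (succ M)    = succ M
  head (ifz M P Q) = ifz M P Q
  head (lam t M)   = lam t M
  head (app M N)   = app M N
  head (coin κ)    = coin κ
  head (fix M)     = fix M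

mutual
  _≟_ : DecidableEquality Term
  M ≟ N with tag M ≟ℕ tag N
  ... | yes p = same-head M (subst (λ k → Head k N) (sym p) (head N))
  ... | no ¬p = no (¬p ∘ cong tag)

  private
    same-head : ∀ M {N} → Head (tag M) N → Dec (M ≡ N)
    same-head (num n)     (num n′)       = map′ (cong num) (λ { refl → refl }) (n ≟ℕ n′)
    same-head (var i)     (var i′)       = map′ (cong var) (λ { refl → refl }) (i ≟ℕ i′)
    same-head (succ M)    (succ M′)      = map′ (cong succ) (λ { refl → refl }) (M ≟ M′)
    same-head (ifz M P Q) (ifz M′ P′ Q′) =
      map′ (λ { (refl , refl , refl) → refl }) (λ { refl → refl , refl , refl })
           (M ≟ M′ ×-dec P ≟ P′ ×-dec Q ≟ Q′)
    same-head (lam t M)   (lam t′ M′)    =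
      map′ (λ { (refl , refl) → refl }) (λ { refl → refl , refl }) (t ≟ᵀ t′ ×-dec M ≟ M′)
    same-head (app M N)   (app M′ N′)    =
      map′ (λ { (refl , refl) → refl }) (λ { refl → refl , refl }) (M ≟ M′ ×-dec N ≟ N′)
    same-head (coin κ)    (coin κ′)      = map′ (cong coin) (λ { refl → refl }) (κ ≟ℚ𝕀 κ′)
    same-head (fix M)     (fix M′)       = map′ (cong fix) (λ { refl → refl }) (M ≟ M′)

Outcomes : Set
Outcomes = List (ℚ𝕀 × Term)

succ-redex : Term → Outcomes
succ-redex (num n) = (1𝕀 , num (suc n)) ∷ []
succ-redex _       = []

app-redex : Term → Term → Outcomes
app-redex (lam t M) N = (1𝕀 , M [ N ]) ∷ []
app-redex _         N = []

ifz-redex : Term → Term → Term → Outcomes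
ifz-redex (num zero)    P Q = (1𝕀 , P) ∷ []
ifz-redex (num (suc n)) P Q = (1𝕀 , Q [ num n ]) ∷ []
ifz-redex _             P Q = []

outcomes : Term → Outcomes
outcomes (num n)     = []
outcomes (var i)     = []
outcomes (succ M)    = succ-redex M ++ map (map₂ succ) (outcomes M)
outcomes (ifz M P Q) = ifz-redex M P Q ++ map (map₂ (λ N → ifz N P Q)) (outcomes M)
outcomes (lam t M)   = []
outcomes (app M N)   = app-redex M N ++ map (map₂ (λ M′ → app M′ N)) (outcomes M)
outcomes (coin κ)    = (κ , num 0) ∷ (1- κ , num 1) ∷ []
outcomes (fix M)     = (1𝕀 , app M (fix M)) ∷ []

outcomes-complete : ∀ {M κ M′} → M —[ κ ]→ M′ → (κ , M′) ∈ outcomes M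
outcomes-complete coin₀      = here refl
outcomes-complete coin₁      = there (here refl)
outcomes-complete unfold     = here refl
outcomes-complete succ-β     = here refl
outcomes-complete lam-β      = here refl
outcomes-complete ifz₀       = here refl
outcomes-complete ifz₊       = here refl
outcomes-complete (succ-ξ {M = M} r) =
  ∈-++⁺ʳ (succ-redex M) (∈-map⁺ _ (outcomes-complete r))
outcomes-complete (app-ξ {M = M} {P = P} r) =
  ∈-++⁺ʳ (app-redex M P) (∈-map⁺ _ (outcomes-complete r))
outcomes-complete (ifz-ξ {M = M} {P = P} {Q = Q} r) =
  ∈-++⁺ʳ (ifz-redex M P Q) (∈-map⁺ _ (outcomes-complete r))

private
  Sound : Term → Outcomes → Set
  Sound M = All λ (κ , M′) → M —[ κ ]→ M′

  map-sound : ∀ {M} (C : Term → Term) → (∀ {κ M′} → M —[ κ ]→ M′ → C M —[ κ ]→ C M′) →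
              ∀ {xs} → Sound M xs → Sound (C M) (map (map₂ C) xs)
  map-sound C ξ []       = []
  map-sound C ξ (r ∷ rs) = ξ r ∷ map-sound C ξ rs

  succ-redex-sound : ∀ M → Sound (succ M) (succ-redex M)
  succ-redex-sound (num n)     = succ-β ∷ []
  succ-redex-sound (var _)     = []
  succ-redex-sound (succ _)    = []
  succ-redex-sound (ifz _ _ _) = []
  succ-redex-sound (lam _ _)   = []
  succ-redex-sound (app _ _)   = []
  succ-redex-sound (coin _)    = []
  succ-redex-sound (fix _)     = []

  app-redex-sound : ∀ M N → Sound (app M N) (app-redex M N)
  app-redex-sound (num n)     N = []
  app-redex-sound (var _)     N = []
  app-redex-sound (succ _)    N = []
  app-redex-sound (ifz _ _ _) N = []
  app-redex-sound (lam _ _)   N = lam-β ∷ []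
  app-redex-sound (app _ _)   N = []
  app-redex-sound (coin _)    N = []
  app-redex-sound (fix _)     N = []

  ifz-redex-sound : ∀ M P Q → Sound (ifz M P Q) (ifz-redex M P Q)
  ifz-redex-sound (num zero)    P Q = ifz₀ ∷ []
  ifz-redex-sound (num (suc n)) P Q = ifz₊ ∷ []
  ifz-redex-sound (var _)       P Q = []
  ifz-redex-sound (succ _)      P Q = []
  ifz-redex-sound (ifz _ _ _)   P Q = []
  ifz-redex-sound (lam _ _)     P Q = []
  ifz-redex-sound (app _ _)     P Q = []
  ifz-redex-sound (coin _)      P Q = []
  ifz-redex-sound (fix _)       P Q = []

outcomes-sound : ∀ M → All (λ (κ , M′) → M —[ κ ]→ M′) (outcomes M)
outcomes-sound (num n)     = []
outcomes-sound (var i)     = []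
outcomes-sound (succ M)    =
  ++⁺ (succ-redex-sound M) (map-sound succ succ-ξ (outcomes-sound M))
outcomes-sound (ifz M P Q) =
  ++⁺ (ifz-redex-sound M P Q) (map-sound (λ N → ifz N P Q) ifz-ξ (outcomes-sound M))
outcomes-sound (lam t M)   = []
outcomes-sound (app M N)   =
  ++⁺ (app-redex-sound M N) (map-sound (λ M′ → app M′ N) app-ξ (outcomes-sound M))
outcomes-sound (coin κ)    = coin₀ ∷ coin₁ ∷ []
outcomes-sound (fix M)     = unfold ∷ []

reduces? : ∀ M M′ → Dec (∃ λ κ → M —[ κ ]→ M′)
reduces? M M′ = map′
  (λ reachable → let (outcome , N∈ , N≡M′) = find reachable in
     proj₁ outcome , subst (M —[ proj₁ outcome ]→_) N≡M′ (lookup (outcomes-sound M) N∈))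
  (λ (κ , r) → lose (outcomes-complete r) refl)
  (any? (λ p → proj₂ p ≟ M′) (outcomes M))

weakNormal? : ∀ M → Dec (WeakNormal M)
weakNormal? M with outcomes M | outcomes-sound M | (λ {κ} {M′} → outcomes-complete {M} {κ} {M′})
... | []          | _     | complete = yes λ κ M′ r → case-∈[] (complete r)
  where
  case-∈[] : ∀ {x : ℚ𝕀 × Term} → ¬ (x ∈ [])
  case-∈[] ()
... | (κ , M′) ∷ _ | r ∷ _ | _       = no λ normal → normal κ M′ r

Matrix : Set₁
Matrix = Term → Term → ℝ⁺

-- The sum over the countable set of all terms, as the supremum of the sums
-- over its finite subsets.
∑Λ : (Term → ℝ⁺) → ℝ⁺
∑Λ f = sup {I = Σ (List Term) Unique} ([] , []) λ (xs , _) →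
  foldr (λ N s → f N + s) 0ℝ xs

identity : Matrix
identity M M′ = if does (M ≟ M′) then 1ℝ else 0ℝ

infixl 7 _⊠_
_⊠_ : Matrix → Matrix → Matrix
(A ⊠ B) M M′ = ∑Λ λ N → A M N * B N M′

infixr 8 _^_
_^_ : Matrix → ℕ → Matrix
A ^ zero  = identity
A ^ suc k = A ⊠ (A ^ k)

Prob : Matrix
Prob M M′ with reduces? M M′
... | yes (κ , _) = fromℚ𝕀 κ
... | no _        = if does (M ≟ M′ ×-dec weakNormal? M) then 1ℝ else 0ℝ

Prob^∞ : Term → ℕ → ℝ⁺
Prob^∞ M n = sup 0 λ k → (Prob ^ k) M (num n)

⟦_⟧ᵀ : Type → Domain
⟦ nat ⟧ᵀ   = Natᴰ
⟦ t ⇾ u ⟧ᵀ = ⟦ t ⟧ᵀ ⇒ᴰ ⟦ u ⟧ᵀ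

⟨⟨_⟩⟩ : Type → DCPO
⟨⟨ t ⟩⟩ = Domain.dcpo ⟦ t ⟧ᵀ

⟦_⟧ᶜ : Context → DCPO
⟦ [] ⟧ᶜ    = 𝟙
⟦ t ∷ Γ ⟧ᶜ = ⟦ Γ ⟧ᶜ ⊗ ⟨⟨ t ⟩⟩

⟦_⟧ᵛ : ∀ {Γ i t} → Γ ∋ i ⦂ t → (⟦ Γ ⟧ᶜ ⟶ ⟨⟨ t ⟩⟩)
⟦ here ⟧ᵛ    = sndᶜ
⟦ there x ⟧ᵛ = ⟦ x ⟧ᵛ ⊚ fstᶜ

-- The sequence P, Q[0], Q[1], … of the branches of a conditional.
branches : ∀ {Γ D} → (Γ ⟶ D) → (Γ ⊗ Distr ⟶ D) → ℕ → (Γ ⟶ D)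
branches p q zero    = p
branches p q (suc i) = q ⊚ ⟨ idᶜ , constᶜ (e i) ⟩

⟦_⟧ : ∀ {Γ M t} → Γ ⊢ M ⦂ t → (⟦ Γ ⟧ᶜ ⟶ ⟨⟨ t ⟩⟩)
⟦ ⊢var x ⟧           = ⟦ x ⟧ᵛ
⟦ ⊢lam d ⟧           = curryᶜ ⟦ d ⟧
⟦ ⊢app d d′ ⟧        = applyᶜ ⊚ ⟨ ⟦ d ⟧ , ⟦ d′ ⟧ ⟩
⟦ ⊢fix {t = t} d ⟧   = Domain.fixpoint ⟦ t ⟧ᵀ ⊚ ⟦ d ⟧
⟦ ⊢num {n = n} ⟧     = constᶜ (e n)
⟦ ⊢succ d ⟧          = succᶜ ⊚ ⟦ d ⟧
⟦ ⊢coin {κ = κ} ⟧    = constᶜ (coinᴰ κ)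
⟦ ⊢ifz {t = t} m p q ⟧ =
  Domain.countable-sum ⟦ t ⟧ᵀ ⊚ ⟨ ⟦ m ⟧ , seqᶜ (branches ⟦ p ⟧ ⟦ q ⟧) ⟩

-- The n-th entry of the denotation of a closed term of type nat.
entry : ∀ {M} → [] ⊢ M ⦂ nat → ℕ → ℝ⁺
entry d n = prob (⟦ d ⟧ · tt) n

{-# OPTIONS --safe #-}

-- Soundness (≥): the denotation of a closed term dominates the weighted sum of
-- the denotations of its one-step reducts, so by induction on k it dominates
-- the probability of reaching n in k steps.
--
-- Adequacy (≤): a logical relation between terms and denotations, which at nat
-- says that the denotation is bounded by Prob^∞, relates every typed term to
-- its denotation.  It is closed under expansion along deterministic steps and
-- under directed suprema, which covers fix.  Conditionals are treated at every
-- type at once by plugging a term M into an evaluation context C: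
-- Σᵢ Prob^∞(M, i) · Prob^∞(C[i], n) ≤ Prob^∞(C[M], n).

module Submission where

open import Defs
open import Data.List using (List; []; _∷_; _++_; map; foldr)
import Data.List.Membership.DecPropositional as DecMembership
open import Data.List.Membership.Propositional using (_∈_; _∉_)
open import Data.List.Membership.Propositional.Properties
  using (∈-map⁺; ∈-++⁻; ∈-++⁺ˡ; ∈-++⁺ʳ; ∈-∃++)
open import Data.List.Properties using (map-∘; map-id)
open import Data.List.Relation.Unary.All as All using (All; []; _∷_)
open import Data.List.Relation.Unary.AllPairs as AllPairs using (AllPairs; []; _∷_)
import Data.List.Relation.Unary.AllPairs.Properties as AllPairsₚ
open import Data.List.Relation.Unary.Any using (here; there)
open import Data.List.Relation.Unary.Unique.Propositional using (Unique)
open import Data.Nat using (ℕ; zero; suc)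
import Data.Nat as ℕ
import Data.Nat.Properties as ℕₚ
open import Data.Product using (∃; ∃₂; _×_; _,_; proj₁; proj₂; map₂)
open import Data.Rational as ℚ using (ℚ; 0ℚ; 1ℚ)
import Data.Rational.Properties as ℚₚ
open import Data.Sum using (_⊎_; inj₁; inj₂)
open import Data.Unit.Polymorphic using (⊤; tt)
open import Function using (_∘_; id; const; case_of_)
open import Level using (Lift; lift; lower; 0ℓ) renaming (suc to lsuc)
open import Relation.Binary.Construct.Interior.Symmetric using (_,_)
open import Relation.Binary.PropositionalEquality
  using (_≡_; _≢_; refl; sym; trans; cong; cong₂; subst)
open import Relation.Nullary using (¬_; Dec; yes; no)

-- Arithmetic of lower reals

private
  pos : ℚ → ℚ
  pos p = 0ℚ ℚ.⊔ p

  pos≥0 : ∀ p → 0ℚ ℚ.≤ pos p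
  pos≥0 p = ℚₚ.p≤p⊔q 0ℚ p

  pos-subadditive : ∀ a b → pos (a ℚ.+ b) ℚ.≤ pos a ℚ.+ pos b
  pos-subadditive a b = ℚₚ.⊔-lub
    (ℚₚ.+-mono-≤ (pos≥0 a) (pos≥0 b))
    (ℚₚ.+-mono-≤ (ℚₚ.p≤q⊔p 0ℚ a) (ℚₚ.p≤q⊔p 0ℚ b))

  p-q+q≡p : ∀ p q → (p ℚ.- q) ℚ.+ q ≡ p
  p-q+q≡p p q = trans (ℚₚ.+-assoc p (ℚ.- q) q)
    (trans (cong (p ℚ.+_) (ℚₚ.+-inverseˡ q)) (ℚₚ.+-identityʳ p))

  p+q-q≡p : ∀ p q → (p ℚ.+ q) ℚ.- q ≡ p
  p+q-q≡p p q = trans (ℚₚ.+-assoc p q (ℚ.- q))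
    (trans (cong (p ℚ.+_) (ℚₚ.+-inverseʳ q)) (ℚₚ.+-identityʳ p))

  -- Density supplies `c` strictly between `q - b` and `a`; then `q - c` is strictly below `b`.
  split-< : ∀ {q} a b → q ℚ.< a ℚ.+ b → ∃₂ λ c d → c ℚ.< a × d ℚ.< b × q ≡ c ℚ.+ d
  split-< {q} a b q<a+b =
    let (c , q-b<c , c<a) = ℚₚ.<-dense
          (subst (q ℚ.- b ℚ.<_) (p+q-q≡p a b) (ℚₚ.+-monoˡ-< (ℚ.- b) q<a+b))
        q<c+b = subst (ℚ._< c ℚ.+ b) (p-q+q≡p q b) (ℚₚ.+-monoˡ-< b q-b<c)
        d<b = subst (q ℚ.- c ℚ.<_)
                (trans (cong (ℚ._- c) (ℚₚ.+-comm c b)) (p+q-q≡p b c))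
                (ℚₚ.+-monoˡ-< (ℚ.- c) q<c+b)
    in c , q ℚ.- c , c<a , d<b , sym (trans (ℚₚ.+-comm c (q ℚ.- c)) (p-q+q≡p q c))

  -- The second factor can be lowered a little: for positive `pos a`, divide by it and use density.
  -- If `pos a` is zero then `q` is negative, a case that callers settle because every cut contains
  -- the negative rationals.
  pos*-approx : ∀ {q} a p → q ℚ.< pos a ℚ.* p →
                q ℚ.< 0ℚ ⊎ ∃ λ r → r ℚ.< p × q ℚ.< pos a ℚ.* pos r
  pos*-approx {q} a p q< with pos a ℚ.≟ 0ℚ
  ... | yes A≡0 = inj₁ (subst (q ℚ.<_) (trans (cong (ℚ._* p) A≡0) (ℚₚ.*-zeroˡ p)) q<)
  ... | no A≢0 =
    let (r , q/A<r , r<p) = ℚₚ.<-dense (subst (q ℚ.* ℚ.1/ A ℚ.<_) A*p/A≡p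
                              (ℚₚ.*-monoˡ-<-pos (ℚ.1/ A) {{ℚₚ.1/pos⇒pos A}} q<))
        q<A*r = subst (ℚ._< A ℚ.* r) A*q/A≡q (ℚₚ.*-monoʳ-<-pos A q/A<r)
    in inj₂ (r , r<p , ℚₚ.<-≤-trans q<A*r
         (ℚₚ.*-monoˡ-≤-nonNeg A {{ℚ.nonNegative (pos≥0 a)}} (ℚₚ.p≤q⊔p 0ℚ r)))
    where
    A : ℚ
    A = pos a
    instance
      A-positive : ℚ.Positive A
      A-positive = ℚₚ.nonNeg∧nonZero⇒pos A {{ℚ.nonNegative (pos≥0 a)}} {{ℚ.≢-nonZero A≢0}}
      A-nonZero : ℚ.NonZero A
      A-nonZero = ℚₚ.pos⇒nonZero A
    A*p/A≡p : A ℚ.* p ℚ.* ℚ.1/ A ≡ p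
    A*p/A≡p = trans (cong (ℚ._* ℚ.1/ A) (ℚₚ.*-comm A p))
      (trans (ℚₚ.*-assoc p A (ℚ.1/ A))
      (trans (cong (p ℚ.*_) (ℚₚ.*-inverseʳ A)) (ℚₚ.*-identityʳ p)))
    A*q/A≡q : A ℚ.* (q ℚ.* ℚ.1/ A) ≡ q
    A*q/A≡q = trans (ℚₚ.*-comm A (q ℚ.* ℚ.1/ A))
      (trans (ℚₚ.*-assoc q (ℚ.1/ A) A)
      (trans (cong (q ℚ.*_) (ℚₚ.*-inverseˡ A)) (ℚₚ.*-identityʳ q)))

*-comm : ∀ x y → x * y ≤ y * x
*-comm x y = mk≤ λ {q} (a , b , xa , yb , q<) →
  b , a , yb , xa , subst (q ℚ.<_) (ℚₚ.*-comm (pos a) (pos b)) q<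

-- Cuts of products are defined by a strict inequality, so `q` has to be split into summands
-- strictly below the two products; `split-<` does this.
*-distribˡ-≥ : ∀ x y z → x * (y + z) ≤ x * y + x * z
*-distribˡ-≥ x y z = mk≤ λ {q} (a , c , xa , (b , b′ , yb , zb′ , c≤) , q<) →
  let pos-c≤ = ℚₚ.≤-trans (ℚₚ.⊔-monoʳ-≤ 0ℚ c≤) (pos-subadditive b b′)
      q<′ = ℚₚ.<-≤-trans q<
        (subst (pos a ℚ.* pos c ℚ.≤_) (ℚₚ.*-distribˡ-+ (pos a) (pos b) (pos b′))
          (ℚₚ.*-monoˡ-≤-nonNeg (pos a) {{ℚ.nonNegative (pos≥0 a)}} pos-c≤))
      (d , d′ , d< , d′< , q≡) = split-< _ _ q<′
  in d , d′ , (a , b , xa , yb , d<) , (a , b′ , xa , zb′ , d′<) , ℚₚ.≤-reflexive q≡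

*-distribʳ-≥ : ∀ x y z → (x + y) * z ≤ x * z + y * z
*-distribʳ-≥ x y z = ≤-trans (*-comm (x + y) z)
  (≤-trans (*-distribˡ-≥ z x y) (+-mono (*-comm z x) (*-comm z y)))

*-distribʳ-≤ : ∀ x y z → x * z + y * z ≤ (x + y) * z
*-distribʳ-≤ x y z = ≤-trans (+-mono (*-comm x z) (*-comm y z))
  (≤-trans (*-distrib-≤ z x y) (*-comm z (x + y)))

*-zeroˡ-≤ : ∀ {x} y → x ≤ 0ℝ → x * y ≤ 0ℝ
*-zeroˡ-≤ y x≤0 = mk≤ λ {q} (a , b , xa , yb , q<) →
  subst (q ℚ.<_)
    (trans (cong (ℚ._* pos b) (ℚₚ.p≥q⇒p⊔q≡p (ℚₚ.<⇒≤ (at x≤0 xa)))) (ℚₚ.*-zeroˡ (pos b))) q<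

*-zeroʳ-≤ : ∀ x {y} → y ≤ 0ℝ → x * y ≤ 0ℝ
*-zeroʳ-≤ x {y} y≤0 = ≤-trans (*-comm x y) (*-zeroˡ-≤ x y≤0)

*-assoc-≤ : ∀ x y z → (x * y) * z ≤ x * (y * z)
*-assoc-≤ x y z = mk≤ λ {q} (d , c , (a , b , xa , yb , d<) , zc , q<) →
  -- The rational `d` witnessing the inner product on the left is eliminated; the inner product on
  -- the right needs a new witness `r`, obtained from `pos*-approx`.
  let pos-d≤ = ℚₚ.⊔-lub (0≤pos*pos a b) (ℚₚ.<⇒≤ d<)
      q<abc = ℚₚ.<-≤-trans q< (ℚₚ.≤-trans
        (ℚₚ.*-monoʳ-≤-nonNeg (pos c) {{ℚ.nonNegative (pos≥0 c)}} pos-d≤)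
        (ℚₚ.≤-reflexive (ℚₚ.*-assoc (pos a) (pos b) (pos c))))
  in case pos*-approx a (pos b ℚ.* pos c) q<abc of λ where
       (inj₁ q<0)              → negative (x * (y * z)) q<0
       (inj₂ (r , r<bc , q<ar)) → a , r , xa , (b , c , yb , zc , r<bc) , q<ar
  where
  0≤pos*pos : ∀ a b → 0ℚ ℚ.≤ pos a ℚ.* pos b
  0≤pos*pos a b = subst (ℚ._≤ pos a ℚ.* pos b) (ℚₚ.*-zeroʳ (pos a))
    (ℚₚ.*-monoˡ-≤-nonNeg (pos a) {{ℚ.nonNegative (pos≥0 a)}} (pos≥0 b))

*-assoc-≥ : ∀ x y z → x * (y * z) ≤ (x * y) * z
*-assoc-≥ x y z =
  ≤-trans (*-comm x (y * z))
  (≤-trans (*-mono (*-comm y z) ≤-refl)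
  (≤-trans (*-assoc-≤ z y x)
  (≤-trans (*-comm z (y * x)) (*-mono (*-comm y x) ≤-refl))))

*-identityʳ-≥ : ∀ x → x ≤ x * 1ℝ
*-identityʳ-≥ x = mk≤ λ {q} xq →
  let (r , q<r , xr) = rounded x xq
      q<r*1 = ℚₚ.<-≤-trans q<r
        (subst (r ℚ.≤_) (sym (ℚₚ.*-identityʳ (pos r))) (ℚₚ.p≤q⊔p 0ℚ r))
  in case pos*-approx r 1ℚ q<r*1 of λ where
       (inj₁ q<0)             → negative (x * 1ℝ) q<0
       (inj₂ (s , s<1 , q<rs)) → r , s , xr , s<1 , q<rs

*-identityˡ-≥ : ∀ x → x ≤ 1ℝ * x
*-identityˡ-≥ x = ≤-trans (*-identityʳ-≥ x) (*-comm x 1ℝ)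

*-identityˡ-≤ : ∀ x → 1ℝ * x ≤ x
*-identityˡ-≤ x = ≤-trans (*-comm 1ℝ x) (*-identityʳ-≤ ≤-refl)

≤-reflexive : ∀ {x y} → x ≡ y → x ≤ y
≤-reflexive refl = ≤-refl

+-identityʳ-≤ : ∀ {x y} → y ≤ 0ℝ → x + y ≤ x
+-identityʳ-≤ {x} {y} y≤0 = ≤-trans (+-comm x y) (+-identityˡ-≤ y≤0)

1*x+0≤x : ∀ {x} → 1ℝ * x + 0ℝ ≤ x
1*x+0≤x {x} = ≤-trans (+-identityʳ-≤ ≤-refl) (*-identityˡ-≤ x)

sup-const-* : ∀ {I : Set} {i₀ : I} x (y : I → ℝ⁺) → x * sup i₀ y ≤ sup i₀ (λ i → x * y i)
sup-const-* x y = mk≤ λ (a , b , xa , (i , yb) , q<) → i , a , b , xa , yb , q<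

-- Finite sums over the naturals

∑<-+-≥ : ∀ k (f g : ℕ → ℝ⁺) → ∑< k f + ∑< k g ≤ ∑< k (λ i → f i + g i)
∑<-+-≥ zero    f g = +-identityˡ-≤ ≤-refl
∑<-+-≥ (suc k) f g =
  ≤-trans (+-interchange (f 0) _ (g 0) _) (+-mono ≤-refl (∑<-+-≥ k (f ∘ suc) (g ∘ suc)))

∑<-*-≥ : ∀ k x (f : ℕ → ℝ⁺) → x * ∑< k f ≤ ∑< k (λ i → x * f i)
∑<-*-≥ zero    x f = *-zeroʳ-≤ x ≤-refl
∑<-*-≥ (suc k) x f =
  ≤-trans (*-distribˡ-≥ x (f 0) (∑< k (f ∘ suc))) (+-mono ≤-refl (∑<-*-≥ k x (f ∘ suc)))

∑<-term : ∀ {k i} → i ℕ.< k → (f : ℕ → ℝ⁺) → f i ≤ ∑< k f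
∑<-term {i = zero}  (ℕ.s≤s _)   f = ≤-+ˡ (f 0) _
∑<-term {i = suc i} (ℕ.s≤s i<k) f = ≤-trans (∑<-term i<k (f ∘ suc)) (≤-+ʳ (f 0) _)

∑<-extend : ∀ {k l} → k ℕ.≤′ l → (f : ℕ → ℝ⁺) → ∑< k f ≤ ∑< l f
∑<-extend ℕ.≤′-refl           f = ≤-refl
∑<-extend (ℕ.≤′-step {l} k≤l) f = ≤-trans (∑<-extend k≤l f) (∑<-grow l f)

-- Deciding `P` at each index locates the only summand that may be nonzero; uniqueness makes all
-- later summands vanish.
∑<-unique : ∀ {P : ℕ → Set} (P? : ∀ i → Dec (P i)) → (∀ {i j} → P i → P j → i ≡ j) →
            ∀ {f y} → (∀ {i} → P i → f i ≤ y) → (∀ {i} → ¬ P i → f i ≤ 0ℝ) →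
            ∀ k → ∑< k f ≤ y
∑<-unique P? unique f≤y f≤0 zero = 0≤ _
∑<-unique P? unique f≤y f≤0 (suc k) with P? 0
... | no ¬p = ≤-trans (+-identityˡ-≤ (f≤0 ¬p))
  (∑<-unique (P? ∘ suc) (λ p q → ℕₚ.suc-injective (unique p q)) f≤y f≤0 k)
... | yes p = ≤-trans (+-mono (f≤y p) (≤-trans
    (∑<-mono k λ i → f≤0 λ q → ℕₚ.0≢1+n (unique p q)) (∑<-zero k)))
  (+-identityʳ-≤ ≤-refl)

-- A list of weighted outcomes acts on functions as a finitely supported measure.
expect : ∀ {A : Set} → List (ℚ𝕀 × A) → (A → ℝ⁺) → ℝ⁺
expect []             f = 0ℝ
expect ((κ , a) ∷ os) f = fromℚ𝕀 κ * f a + expect os f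

module _ {A : Set} where

  expect-mono : ∀ (os : List (ℚ𝕀 × A)) {f g : A → ℝ⁺} → (∀ a → f a ≤ g a) →
                expect os f ≤ expect os g
  expect-mono []             f≤g = ≤-refl
  expect-mono ((κ , a) ∷ os) f≤g = +-mono (*-mono ≤-refl (f≤g a)) (expect-mono os f≤g)

  expect-map : ∀ {B : Set} (h : A → B) os (f : B → ℝ⁺) →
               expect (map (map₂ h) os) f ≡ expect os (f ∘ h)
  expect-map h []             f = refl
  expect-map h ((κ , a) ∷ os) f = cong (fromℚ𝕀 κ * f (h a) +_) (expect-map h os f)

  expect-zero : ∀ (os : List (ℚ𝕀 × A)) → expect os (const 0ℝ) ≤ 0ℝ
  expect-zero []             = ≤-refl
  expect-zero ((κ , a) ∷ os) =
    ≤-trans (+-identityˡ-≤ (*-zeroʳ-≤ (fromℚ𝕀 κ) ≤-refl)) (expect-zero os)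

  expect-dirac-≤ : ∀ (a : A) f → expect ((1𝕀 , a) ∷ []) f ≤ f a
  expect-dirac-≤ a f = 1*x+0≤x

  expect-dirac-≥ : ∀ (a : A) f → f a ≤ expect ((1𝕀 , a) ∷ []) f
  expect-dirac-≥ a f = ≤-trans (*-identityˡ-≥ (f a)) (≤-+ˡ _ 0ℝ)

  expect-*-≤ : ∀ (os : List (ℚ𝕀 × A)) f x → expect os f * x ≤ expect os (λ a → f a * x)
  expect-*-≤ []             f x = *-zeroˡ-≤ x ≤-refl
  expect-*-≤ ((κ , a) ∷ os) f x = ≤-trans (*-distribʳ-≥ _ _ x)
    (+-mono (*-assoc-≤ (fromℚ𝕀 κ) (f a) x) (expect-*-≤ os f x))

  expect-*-≥ : ∀ (os : List (ℚ𝕀 × A)) f x → expect os (λ a → f a * x) ≤ expect os f * x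
  expect-*-≥ []             f x = 0≤ _
  expect-*-≥ ((κ , a) ∷ os) f x = ≤-trans
    (+-mono (*-assoc-≥ (fromℚ𝕀 κ) (f a) x) (expect-*-≥ os f x)) (*-distribʳ-≤ _ _ x)

  expect-∑<-≤ : ∀ (os : List (ℚ𝕀 × A)) k (f : A → ℕ → ℝ⁺) →
                expect os (λ a → ∑< k (f a)) ≤ ∑< k (λ i → expect os (λ a → f a i))
  expect-∑<-≤ []             k f = 0≤ _
  expect-∑<-≤ ((κ , a) ∷ os) k f = ≤-trans
    (+-mono (∑<-*-≥ k (fromℚ𝕀 κ) (f a)) (expect-∑<-≤ os k f)) (∑<-+-≥ k _ _)

  expect-∑<-≥ : ∀ (os : List (ℚ𝕀 × A)) k (f : A → ℕ → ℝ⁺) →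
                ∑< k (λ i → expect os (λ a → f a i)) ≤ expect os (λ a → ∑< k (f a))
  expect-∑<-≥ []             k f = ∑<-zero k
  expect-∑<-≥ ((κ , a) ∷ os) k f = ≤-trans (∑<-+ k _ _)
    (+-mono (∑<-* k (fromℚ𝕀 κ) (f a)) (expect-∑<-≥ os k f))

  expect-sup : ∀ {I : Set} {i₀ : I} (os : List (ℚ𝕀 × A)) (f : A → I → ℝ⁺) →
               (∀ i j → ∃ λ k → (∀ a → f a i ≤ f a k) × (∀ a → f a j ≤ f a k)) →
               expect os (λ a → sup i₀ (f a)) ≤ sup i₀ (λ i → expect os (λ a → f a i))
  expect-sup []             f dir = 0≤ _
  expect-sup ((κ , a) ∷ os) f dir = ≤-trans
    (+-mono (sup-const-* (fromℚ𝕀 κ) (f a)) (expect-sup os f dir))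
    (sup-+ (λ i → fromℚ𝕀 κ * f a i) (λ i → expect os (λ a → f a i)) λ i j →
      let (k , p , q) = dir i j in k , *-mono ≤-refl (p a) , expect-mono os q)

-- Reduction and the matrix Prob

-- Lumps together the six term formers that create no redex in head position, so that case analyses
-- need not enumerate them.
data Form : Term → Set where
  numeral     : ∀ n → Form (num n)
  abstraction : ∀ t M → Form (lam t M)
  other       : ∀ {M} → succ-redex M ≡ [] → (∀ N → app-redex M N ≡ []) →
                (∀ P Q → ifz-redex M P Q ≡ []) → Form M

form : ∀ M → Form M
form (num n)     = numeral n
form (var _)     = other refl (λ _ → refl) (λ _ _ → refl)
form (succ _)    = other refl (λ _ → refl) (λ _ _ → refl)
form (ifz _ _ _) = other refl (λ _ → refl) (λ _ _ → refl)
form (lam t M)   = abstraction t M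
form (app _ _)   = other refl (λ _ → refl) (λ _ _ → refl)
form (coin _)    = other refl (λ _ → refl) (λ _ _ → refl)
form (fix _)     = other refl (λ _ → refl) (λ _ _ → refl)

-- At most one of the contraction at the root and the reduction of the head applies.
data Exclusive : Outcomes → Outcomes → Set where
  root : ∀ {o} → Exclusive (o ∷ []) []
  head : ∀ {os} → Exclusive [] os

succ-exclusive : ∀ M → Exclusive (succ-redex M) (outcomes M)
succ-exclusive M with form M
... | numeral n         = root
... | abstraction t M   = head
... | other eq _ _ rewrite eq = head

app-exclusive : ∀ M N → Exclusive (app-redex M N) (outcomes M)
app-exclusive M N with form M
... | numeral n         = head
... | abstraction t M   = root
... | other _ eq _ rewrite eq N = head

ifz-exclusive : ∀ M P Q → Exclusive (ifz-redex M P Q) (outcomes M)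
ifz-exclusive M P Q with form M
... | numeral zero      = root
... | numeral (suc n)   = root
... | abstraction t M   = head
... | other _ _ eq rewrite eq P Q = head

-- Prob is indexed by the target of a step, so it agrees with the list of
-- outcomes only because no target occurs twice.
DistinctTargets : Outcomes → Set
DistinctTargets = AllPairs λ o o′ → proj₂ o ≢ proj₂ o′

distinct-map : ∀ (C : Term → Term) → (∀ {M N} → C M ≡ C N → M ≡ N) →
               ∀ {redex os} → Exclusive redex os → DistinctTargets os →
               DistinctTargets (redex ++ map (map₂ C) os)
distinct-map C injective root d = [] ∷ []
distinct-map C injective head d = AllPairsₚ.map⁺ (AllPairs.map (λ M≢N → M≢N ∘ injective) d)

outcomes-distinct : ∀ M → DistinctTargets (outcomes M)
outcomes-distinct (num n)     = []
outcomes-distinct (var i)     = []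
outcomes-distinct (succ M)    =
  distinct-map succ (λ { refl → refl }) (succ-exclusive M) (outcomes-distinct M)
outcomes-distinct (ifz M P Q) =
  distinct-map (λ N → ifz N P Q) (λ { refl → refl }) (ifz-exclusive M P Q) (outcomes-distinct M)
outcomes-distinct (lam t M)   = []
outcomes-distinct (app M N)   =
  distinct-map (λ M′ → app M′ N) (λ { refl → refl }) (app-exclusive M N) (outcomes-distinct M)
outcomes-distinct (coin κ)    = ((λ ()) ∷ []) ∷ [] ∷ []
outcomes-distinct (fix M)     = [] ∷ []

distinct-weight : ∀ {os κ κ′ N} → DistinctTargets os → (κ , N) ∈ os → (κ′ , N) ∈ os → κ ≡ κ′
distinct-weight (_ ∷ _) (here refl) (here refl) = refl
distinct-weight (d ∷ _) (here refl) (there q)   with () ← All.lookup d q refl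
distinct-weight (d ∷ _) (there p)   (here refl) with () ← All.lookup d p refl
distinct-weight (_ ∷ d) (there p)   (there q)   = distinct-weight d p q

-- An extensional notion of evaluation context. It is restricted to an `M` that steps, since
-- plugging in a numeral or an abstraction may create a redex of `C` itself.
Evaluation : (Term → Term) → Set
Evaluation C = ∀ M {o os} → outcomes M ≡ o ∷ os → outcomes (C M) ≡ map (map₂ C) (outcomes M)

exclusive-head : ∀ {redex os o os′} (C : Term → Term) → Exclusive redex os → os ≡ o ∷ os′ →
                 redex ++ map (map₂ C) os ≡ map (map₂ C) os
exclusive-head C head _ = refl

evaluation-succ : Evaluation succ
evaluation-succ M = exclusive-head succ (succ-exclusive M)

evaluation-ifz : ∀ P Q → Evaluation (λ M → ifz M P Q)
evaluation-ifz P Q M = exclusive-head (λ M → ifz M P Q) (ifz-exclusive M P Q)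

evaluation-hole : Evaluation id
evaluation-hole M _ = sym (map-id (outcomes M))

-- Closure under application frames is what makes the induction on types in `computable-partial`
-- possible. As `M` steps, so does `C M`, which rules out a contraction at the new root.
evaluation-app : ∀ {C} N → Evaluation C → Evaluation (λ M → app (C M) N)
evaluation-app {C} N eval M M-steps =
  trans (exclusive-head (λ M → app M N) (app-exclusive (C M) N)
          (trans (eval M M-steps) (cong (map (map₂ C)) M-steps)))
  (trans (cong (map (map₂ (λ M → app M N))) (eval M M-steps))
         (sym (map-∘ (outcomes M))))

-- Staying put with weight 1 mirrors the diagonal entries of `Prob` at weak-normal terms, so that
-- `successors M` covers the support of row `M`.
orStay : Term → Outcomes → Outcomes
orStay M []         = (1𝕀 , M) ∷ []
orStay M os@(_ ∷ _) = os

successors : Term → Outcomes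
successors M = orStay M (outcomes M)

orStay-distinct : ∀ M {os} → DistinctTargets os → DistinctTargets (orStay M os)
orStay-distinct M []       = [] ∷ []
orStay-distinct M (d ∷ ds) = d ∷ ds

∈-orStay : ∀ M {os o} → o ∈ os → o ∈ orStay M os
∈-orStay M (here p)  = here p
∈-orStay M (there p) = there p

∈-successors⁻ : ∀ {M κ N} → (κ , N) ∈ successors M →
                M —[ κ ]→ N ⊎ (κ ≡ 1𝕀 × N ≡ M × WeakNormal M)
∈-successors⁻ {M} p with outcomes M | outcomes-sound M | outcomes-complete {M}
∈-successors⁻ (here refl) | [] | _ | complete = inj₂ (refl , refl , λ κ M′ r → ∉[] (complete r))
  where
  ∉[] : ∀ {o : ℚ𝕀 × Term} → o ∉ []
  ∉[] ()
∈-successors⁻ p | _ ∷ _ | sound | _ = inj₁ (All.lookup sound p)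

normal-successor : ∀ {M} → WeakNormal M → (1𝕀 , M) ∈ successors M
normal-successor {M} normal with outcomes M | outcomes-sound M
... | []          | _     = here refl
... | (κ , N) ∷ _ | r ∷ _ with () ← normal κ N r

-- `Prob` uses whichever step `reduces?` happens to find; distinctness of targets forces its weight
-- to be `κ`.
Prob-successor : ∀ {M κ N} → (κ , N) ∈ successors M → Prob M N ≡ fromℚ𝕀 κ
Prob-successor {M} {κ} {N} p with reduces? M N
... | yes (κ′ , r) = cong fromℚ𝕀 (distinct-weight (orStay-distinct M (outcomes-distinct M))
                       (∈-orStay M (outcomes-complete r)) p)
... | no ¬r with ∈-successors⁻ {M} p
...   | inj₁ r with () ← ¬r (κ , r)
...   | inj₂ (refl , refl , normal) with M ≟ M | weakNormal? M
...     | yes _ | yes _  = refl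
...     | yes _ | no ¬n with () ← ¬n normal
...     | no ¬eq | _    with () ← ¬eq refl

Prob-nonsuccessor : ∀ {M N} → (∀ {κ} → (κ , N) ∉ successors M) → Prob M N ≤ 0ℝ
Prob-nonsuccessor {M} {N} ∉s with reduces? M N
... | yes (κ , r) with () ← ∉s (∈-orStay M (outcomes-complete r))
... | no _ with M ≟ N | weakNormal? M
...   | yes refl | yes normal with () ← ∉s (normal-successor normal)
...   | yes _    | no _  = ≤-refl
...   | no _     | _     = ≤-refl

-- Rows of `Prob` as finite sums

∑ᵀ : (Term → ℝ⁺) → List Term → ℝ⁺
∑ᵀ g = foldr (λ N s → g N + s) 0ℝ

∑ᵀ-insert : ∀ g xs {y ys} → g y + ∑ᵀ g (xs ++ ys) ≤ ∑ᵀ g (xs ++ y ∷ ys)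
∑ᵀ-insert g []       = ≤-refl
∑ᵀ-insert g (x ∷ xs) = ≤-trans (+-assocˡ _ _ _) (≤-trans (+-mono (+-comm _ _) ≤-refl)
  (≤-trans (+-assocʳ _ _ _) (+-mono ≤-refl (∑ᵀ-insert g xs))))

-- Each element of `xs` either contributes nothing or is cancelled against an occurrence in `ys`,
-- which is then deleted.
∑ᵀ-support : ∀ g {xs} → Unique xs → ∀ ys → (∀ {N} → N ∈ xs → N ∉ ys → g N ≤ 0ℝ) →
             ∑ᵀ g xs ≤ ∑ᵀ g ys
∑ᵀ-support g [] ys g≤0 = 0≤ _
∑ᵀ-support g {x ∷ xs} (x∉xs ∷ unique) ys g≤0 with x ∈? ys
  where open DecMembership _≟_ using (_∈?_)
... | no x∉ys = ≤-trans (+-identityˡ-≤ (g≤0 (here refl) x∉ys))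
  (∑ᵀ-support g unique ys (g≤0 ∘ there))
... | yes x∈ys with ∈-∃++ x∈ys
...   | us , vs , refl = ≤-trans
  (+-mono ≤-refl (∑ᵀ-support g unique (us ++ vs) λ N∈xs N∉ → g≤0 (there N∈xs) λ N∈ → N∉
    -- Deleting `x` from `ys` loses no element of the tail of `xs`, because `x` does not recur
    -- there.
    (case ∈-++⁻ us N∈ of λ where
      (inj₁ p)            → ∈-++⁺ˡ p
      (inj₂ (here N≡x))   → case All.lookup x∉xs N∈xs (sym N≡x) of λ ()
      (inj₂ (there p))    → ∈-++⁺ʳ us p)))
  (∑ᵀ-insert g us)

∑ᵀ-Prob : ∀ M (f : Term → ℝ⁺) os → (∀ {κ N} → (κ , N) ∈ os → Prob M N ≡ fromℚ𝕀 κ) →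
          ∑ᵀ (λ N → Prob M N * f N) (map proj₂ os) ≡ expect os f
∑ᵀ-Prob M f []             Prob≡ = refl
∑ᵀ-Prob M f ((κ , N) ∷ os) Prob≡ =
  cong₂ _+_ (cong (_* f N) (Prob≡ (here refl))) (∑ᵀ-Prob M f os (Prob≡ ∘ there))

∑Λ-Prob-≤ : ∀ M (f : Term → ℝ⁺) → ∑Λ (λ N → Prob M N * f N) ≤ expect (successors M) f
∑Λ-Prob-≤ M f = subst (∑Λ (λ N → Prob M N * f N) ≤_) (∑ᵀ-Prob M f (successors M) Prob-successor)
  (sup-least _ λ (xs , unique) → ∑ᵀ-support _ unique (map proj₂ (successors M)) λ _ N∉ →
    *-zeroˡ-≤ _ (Prob-nonsuccessor λ p → N∉ (∈-map⁺ proj₂ p)))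

-- The targets of the successors are pairwise distinct, so their list is one of the finite subsets
-- in the supremum.
∑Λ-Prob-≥ : ∀ M (f : Term → ℝ⁺) → expect (successors M) f ≤ ∑Λ (λ N → Prob M N * f N)
∑Λ-Prob-≥ M f = subst (_≤ ∑Λ (λ N → Prob M N * f N)) (∑ᵀ-Prob M f (successors M) Prob-successor)
  (sup-upper _ (map proj₂ (successors M)
    , AllPairsₚ.map⁺ (orStay-distinct M (outcomes-distinct M))))

Prob^-suc-≤ : ∀ k M N → (Prob ^ suc k) M N ≤ expect (successors M) (λ M′ → (Prob ^ k) M′ N)
Prob^-suc-≤ k M N = ∑Λ-Prob-≤ M λ M′ → (Prob ^ k) M′ N

Prob^-suc-≥ : ∀ k M N → expect (successors M) (λ M′ → (Prob ^ k) M′ N) ≤ (Prob ^ suc k) M N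
Prob^-suc-≥ k M N = ∑Λ-Prob-≥ M λ M′ → (Prob ^ k) M′ N

-- Powers of `Prob` and their limit

identity-refl : ∀ M → 1ℝ ≤ identity M M
identity-refl M with M ≟ M
... | yes _  = ≤-refl
... | no M≢M with () ← M≢M refl

identity-≢ : ∀ {M N} → M ≢ N → identity M N ≤ 0ℝ
identity-≢ {M} {N} M≢N with M ≟ N
... | yes M≡N with () ← M≢N M≡N
... | no _    = ≤-refl

identity≤1 : ∀ M N → identity M N ≤ 1ℝ
identity≤1 M N with M ≟ N
... | yes _ = ≤-refl
... | no _  = 0≤ _

Prob^-num : ∀ k n → 1ℝ ≤ (Prob ^ k) (num n) (num n)
Prob^-num zero    n = identity-refl (num n)
Prob^-num (suc k) n = ≤-trans (Prob^-num k n)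
  (≤-trans (expect-dirac-≥ (num n) (λ M → (Prob ^ k) M (num n))) (Prob^-suc-≥ k (num n) (num n)))

-- Numerals are absorbing: what has reached `num n` stays there. The inductive step peels off the
-- first reduction on both sides.
Prob^-grow : ∀ k M n → (Prob ^ k) M (num n) ≤ (Prob ^ suc k) M (num n)
Prob^-grow zero    M n with M ≟ num n
... | yes refl = Prob^-num 1 n
... | no _     = 0≤ _
Prob^-grow (suc k) M n = ≤-trans (Prob^-suc-≤ k M (num n))
  (≤-trans (expect-mono (successors M) λ M′ → Prob^-grow k M′ n) (Prob^-suc-≥ (suc k) M (num n)))

Prob^-mono : ∀ {k l} M n → k ℕ.≤′ l → (Prob ^ k) M (num n) ≤ (Prob ^ l) M (num n)
Prob^-mono M n ℕ.≤′-refl       = ≤-refl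
Prob^-mono M n (ℕ.≤′-step {l} k≤l) = ≤-trans (Prob^-mono M n k≤l) (Prob^-grow l M n)

-- Running `M` for `a` steps to a numeral and then `C` at that numeral for `b` steps gives runs of
-- `C M`, distinct numerals giving disjoint events. The induction on `a` expands the first step of
-- `M`.
Prob^-evaluation : ∀ {C} → Evaluation C → ∀ k a b M n →
  ∑< k (λ i → (Prob ^ a) M (num i) * (Prob ^ b) (C (num i)) (num n)) ≤
  (Prob ^ (a ℕ.+ b)) (C M) (num n)
Prob^-evaluation eval k zero b M n =
  -- With `a` equal to 0 only the summand whose numeral is `M` itself survives.
  ∑<-unique (λ i → M ≟ num i) (λ { refl refl → refl })
    (λ { {i} refl → ≤-trans (*-mono (identity≤1 M (num i)) ≤-refl) (*-identityˡ-≤ _) })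
    (λ M≢ → *-zeroˡ-≤ _ (identity-≢ M≢)) k
Prob^-evaluation {C} eval k (suc a) b M n = ≤-trans
  (∑<-mono k λ i → ≤-trans (*-mono (Prob^-suc-≤ a M (num i)) ≤-refl)
                           (expect-*-≤ (successors M) _ (c i)))
  (≤-trans (expect-∑<-≥ (successors M) k (λ M′ i → (Prob ^ a) M′ (num i) * c i))
  (≤-trans (expect-mono (successors M) λ M′ → Prob^-evaluation eval k a b M′ n)
           last))
  where
  c : ℕ → ℝ⁺
  c i = (Prob ^ b) (C (num i)) (num n)
  last : expect (successors M) (λ M′ → (Prob ^ (a ℕ.+ b)) (C M′) (num n)) ≤
         (Prob ^ suc (a ℕ.+ b)) (C M) (num n)
  last with outcomes M in eq
  -- Here `M` spends its step staying put while `C M` may move on; monotonicity in the exponent pays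
  -- for the extra step.
  ... | []     = ≤-trans (expect-dirac-≤ M (λ M → (Prob ^ (a ℕ.+ b)) (C M) (num n)))
                         (Prob^-grow (a ℕ.+ b) (C M) n)
  ... | o ∷ os = ≤-trans (subst (_≤ expect (successors (C M)) g) stepped ≤-refl)
                         (Prob^-suc-≥ (a ℕ.+ b) (C M) (num n))
    where
    g : Term → ℝ⁺
    g N = (Prob ^ (a ℕ.+ b)) N (num n)
    stepped : expect (successors (C M)) g ≡ expect (o ∷ os) (g ∘ C)
    stepped = trans (cong (λ os → expect (orStay (C M) os) g)
                          (trans (eval M eq) (cong (map (map₂ C)) eq)))
                    (expect-map C (o ∷ os) g)

Prob^-directed : ∀ k l → ∃ λ m → (∀ M n → (Prob ^ k) M (num n) ≤ (Prob ^ m) M (num n)) ×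
                                 (∀ M n → (Prob ^ l) M (num n) ≤ (Prob ^ m) M (num n))
Prob^-directed k l = k ℕ.⊔ l
  , (λ M n → Prob^-mono M n (ℕₚ.≤⇒≤′ (ℕₚ.m≤m⊔n k l)))
  , (λ M n → Prob^-mono M n (ℕₚ.≤⇒≤′ (ℕₚ.m≤n⊔m k l)))

-- Monotonicity in the exponent lets all suprema be taken along one exponent `a`, and the finite
-- bound then lands in the power `a + a`.
Prob^∞-evaluation : ∀ {C} → Evaluation C → ∀ k M n →
  ∑< k (λ i → Prob^∞ M i * Prob^∞ (C (num i)) n) ≤ Prob^∞ (C M) n
Prob^∞-evaluation {C} eval k M n = ≤-trans
  (∑<-mono k λ i → sup-* (λ a → (Prob ^ a) M (num i)) (λ a → (Prob ^ a) (C (num i)) (num n))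
    λ a b → let (m , p , q) = Prob^-directed a b in m , p M i , q (C (num i)) n)
  (≤-trans (∑<-sup k (λ a i → (Prob ^ a) M (num i) * (Prob ^ a) (C (num i)) (num n))
    λ a b → let (m , p , q) = Prob^-directed a b in
      m , (λ i → *-mono (p M i) (p (C (num i)) n)) , (λ i → *-mono (q M i) (q (C (num i)) n)))
  (sup-least _ λ a → ≤-trans (Prob^-evaluation eval k a a M n)
    (sup-upper (λ a → (Prob ^ a) (C M) (num n)) (a ℕ.+ a))))

Prob^∞-successors : ∀ M n → expect (successors M) (λ N → Prob^∞ N n) ≤ Prob^∞ M n
Prob^∞-successors M n = ≤-trans
  (expect-sup (successors M) (λ N a → (Prob ^ a) N (num n)) λ a b →
    let (m , p , q) = Prob^-directed a b in m , (λ N → p N n) , (λ N → q N n))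
  (sup-least _ λ a → ≤-trans (Prob^-suc-≥ a M (num n))
    (sup-upper (λ a → (Prob ^ a) M (num n)) (suc a)))

Prob^∞-num : ∀ n → 1ℝ ≤ Prob^∞ (num n) n
Prob^∞-num n = ≤-trans (Prob^-num 0 n) (sup-upper (λ a → (Prob ^ a) (num n) (num n)) 0)

infix 2 _↪_
-- Deterministic reduction, phrased through `outcomes` so that concrete contractions hold by `refl`.
_↪_ : Term → Term → Set
M ↪ N = outcomes M ≡ (1𝕀 , N) ∷ []

↪-app : ∀ {M M′} N → M ↪ M′ → app M N ↪ app M′ N
↪-app {M} N M↪M′ = trans (evaluation-app N evaluation-hole M M↪M′)
  (cong (map (map₂ (λ M → app M N))) M↪M′)

Prob^∞-expansion : ∀ {M N} → M ↪ N → ∀ n → Prob^∞ N n ≤ Prob^∞ M n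
Prob^∞-expansion {M} {N} M↪N n = ≤-trans (expect-dirac-≥ N (λ N → Prob^∞ N n))
  (subst (λ os → expect (orStay M os) (λ N → Prob^∞ N n) ≤ Prob^∞ M n) M↪N
    (Prob^∞-successors M n))

unit≤ : ∀ {x : ℕ → ℝ⁺} n → 1ℝ ≤ x n → ∀ m → unit n m ≤ x m
unit≤ zero    1≤x zero    = 1≤x
unit≤ zero    1≤x (suc m) = 0≤ _
unit≤ (suc n) 1≤x zero    = 0≤ _
unit≤ {x} (suc n) 1≤x (suc m) = unit≤ {x ∘ suc} n 1≤x m

1≤unit : ∀ n → 1ℝ ≤ unit n n
1≤unit zero    = ≤-refl
1≤unit (suc n) = 1≤unit n

-- Adequacy

Computable : ∀ t → Term → ∣ ⟨⟨ t ⟩⟩ ∣ → Set₁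
Computable nat     M φ = Lift (lsuc 0ℓ) (∀ n → prob φ n ≤ Prob^∞ M n)
Computable (t ⇾ u) M f = ∀ N x → Computable t N x → Computable u (app M N) (f · x)

-- A deterministic step in function position is a deterministic step of the application, which
-- reduces the claim to type `nat`.
computable-expansion : ∀ t {M N x} → M ↪ N → Computable t N x → Computable t M x
computable-expansion nat     M↪N (lift c) = lift λ n → ≤-trans (c n) (Prob^∞-expansion M↪N n)
computable-expansion (t ⇾ u) {M} M↪N c N x cN = computable-expansion u (↪-app {M} N M↪N) (c N x cN)

computable-⊥ : ∀ t {M} → Computable t M (Domain.⊥ᴰ ⟦ t ⟧ᵀ)
computable-⊥ nat     = lift λ n → 0≤ _
computable-⊥ (t ⇾ u) = λ N x _ → computable-⊥ u

computable-⨆ : ∀ t {M} {I : Set} (α : I → ∣ ⟨⟨ t ⟩⟩ ∣) d → (∀ i → Computable t M (α i)) →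
               Computable t M (DCPO.⨆ ⟨⟨ t ⟩⟩ α d)
computable-⨆ nat     α d c = lift λ n → sup-least _ λ i → lower (c i) n
computable-⨆ (t ⇾ u) α d c = λ N x cN → computable-⨆ u _ _ λ i → c i N x cN

-- At an arrow type the argument is absorbed into the context `C`, so at `nat` the context has
-- collected all arguments and `Prob^∞-evaluation` applies.
computable-partial : ∀ t {C} → Evaluation C → ∀ {M v} → Computable nat M v →
  ∀ {x} → (∀ i → Computable t (C (num i)) (x i)) →
  ∀ k → Computable t (C M) (Domain.partial ⟦ t ⟧ᵀ k · (v , x))
computable-partial nat eval {M} (lift cM) cx k = lift λ n →
  ≤-trans (∑<-mono k λ i → *-mono (cM i) (lower (cx i) n)) (Prob^∞-evaluation eval k M n)
computable-partial (t ⇾ u) eval cM cx k = λ N y cN →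
  computable-partial u (evaluation-app N eval) cM (λ i → cx i N y cN) k

-- Composition laws for renaming and substitution

cong-ifz : ∀ {M M′ P P′ Q Q′} → M ≡ M′ → P ≡ P′ → Q ≡ Q′ → ifz M P Q ≡ ifz M′ P′ Q′
cong-ifz refl refl refl = refl

rename-rename : ∀ {ξ ζ υ} → (∀ i → ζ (ξ i) ≡ υ i) → ∀ M → rename ζ (rename ξ M) ≡ rename υ M
rename-rename {ξ} {ζ} {υ} eq = go
  where
  eq↑ : ∀ i → liftʳ ζ (liftʳ ξ i) ≡ liftʳ υ i
  eq↑ zero    = refl
  eq↑ (suc i) = cong suc (eq i)

  go : ∀ M → rename ζ (rename ξ M) ≡ rename υ M
  go (num n)     = refl
  go (var i)     = cong var (eq i)
  go (succ M)    = cong succ (go M)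
  go (ifz M P Q) = cong-ifz (go M) (go P) (rename-rename eq↑ Q)
  go (lam t M)   = cong (lam t) (rename-rename eq↑ M)
  go (app M N)   = cong₂ app (go M) (go N)
  go (coin κ)    = refl
  go (fix M)     = cong fix (go M)

substitute-rename : ∀ {ξ τ υ} → (∀ i → τ (ξ i) ≡ υ i) →
                    ∀ M → substitute τ (rename ξ M) ≡ substitute υ M
substitute-rename {ξ} {τ} {υ} eq = go
  where
  eq↑ : ∀ i → liftˢ τ (liftʳ ξ i) ≡ liftˢ υ i
  eq↑ zero    = refl
  eq↑ (suc i) = cong (rename suc) (eq i)

  go : ∀ M → substitute τ (rename ξ M) ≡ substitute υ M
  go (num n)     = refl
  go (var i)     = eq i
  go (succ M)    = cong succ (go M)
  go (ifz M P Q) = cong-ifz (go M) (go P) (substitute-rename eq↑ Q)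
  go (lam t M)   = cong (lam t) (substitute-rename eq↑ M)
  go (app M N)   = cong₂ app (go M) (go N)
  go (coin κ)    = refl
  go (fix M)     = cong fix (go M)

rename-substitute : ∀ {σ ξ υ} → (∀ i → rename ξ (σ i) ≡ υ i) →
                    ∀ M → rename ξ (substitute σ M) ≡ substitute υ M
rename-substitute {σ} {ξ} {υ} eq = go
  where
  eq↑ : ∀ i → rename (liftʳ ξ) (liftˢ σ i) ≡ liftˢ υ i
  eq↑ zero    = refl
  -- Shifting and then renaming by the lifted `ξ` equals renaming by `ξ` and then shifting: both are
  -- the renaming `suc ∘ ξ`.
  eq↑ (suc i) = trans (rename-rename (λ _ → refl) (σ i))
    (trans (sym (rename-rename (λ _ → refl) (σ i))) (cong (rename suc) (eq i)))

  go : ∀ M → rename ξ (substitute σ M) ≡ substitute υ M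
  go (num n)     = refl
  go (var i)     = eq i
  go (succ M)    = cong succ (go M)
  go (ifz M P Q) = cong-ifz (go M) (go P) (rename-substitute eq↑ Q)
  go (lam t M)   = cong (lam t) (rename-substitute eq↑ M)
  go (app M N)   = cong₂ app (go M) (go N)
  go (coin κ)    = refl
  go (fix M)     = cong fix (go M)

substitute-substitute : ∀ {σ τ υ} → (∀ i → substitute τ (σ i) ≡ υ i) →
                        ∀ M → substitute τ (substitute σ M) ≡ substitute υ M
substitute-substitute {σ} {τ} {υ} eq = go
  where
  eq↑ : ∀ i → substitute (liftˢ τ) (liftˢ σ i) ≡ liftˢ υ i
  eq↑ zero    = refl
  eq↑ (suc i) = trans (substitute-rename (λ _ → refl) (σ i))
    (trans (sym (rename-substitute (λ _ → refl) (σ i))) (cong (rename suc) (eq i)))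

  go : ∀ M → substitute τ (substitute σ M) ≡ substitute υ M
  go (num n)     = refl
  go (var i)     = eq i
  go (succ M)    = cong succ (go M)
  go (ifz M P Q) = cong-ifz (go M) (go P) (substitute-substitute eq↑ Q)
  go (lam t M)   = cong (lam t) (substitute-substitute eq↑ M)
  go (app M N)   = cong₂ app (go M) (go N)
  go (coin κ)    = refl
  go (fix M)     = cong fix (go M)

substitute-var : ∀ {σ} → (∀ i → σ i ≡ var i) → ∀ M → substitute σ M ≡ M
substitute-var {σ} eq = go
  where
  eq↑ : ∀ i → liftˢ σ i ≡ var i
  eq↑ zero    = refl
  eq↑ (suc i) = cong (rename suc) (eq i)

  go : ∀ M → substitute σ M ≡ M
  go (num n)     = refl
  go (var i)     = eq i
  go (succ M)    = cong succ (go M)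
  go (ifz M P Q) = cong-ifz (go M) (go P) (substitute-var eq↑ Q)
  go (lam t M)   = cong (lam t) (substitute-var eq↑ M)
  go (app M N)   = cong₂ app (go M) (go N)
  go (coin κ)    = refl
  go (fix M)     = cong fix (go M)

infixr 5 _•_
_•_ : Term → (ℕ → Term) → ℕ → Term
(N • σ) zero    = N
(N • σ) (suc i) = σ i

-- Turns the contractum of a closed-off binder into a single simultaneous substitution, the form in
-- which `adequacy` supplies its induction hypothesis.
substitute-lift-[] : ∀ σ M N → substitute (liftˢ σ) M [ N ] ≡ substitute (N • σ) M
substitute-lift-[] σ M N = substitute-substitute pointwise M
  where
  pointwise : ∀ i → substitute (instantiate N) (liftˢ σ i) ≡ (N • σ) i
  pointwise zero    = refl
  pointwise (suc i) = trans (substitute-rename (λ _ → refl) (σ i))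
                            (substitute-var (λ _ → refl) (σ i))

-- The fundamental lemma of the logical relation

ComputableEnv : ∀ Γ → (ℕ → Term) → ∣ ⟦ Γ ⟧ᶜ ∣ → Set₁
ComputableEnv Γ σ ρ = ∀ {i t} (x : Γ ∋ i ⦂ t) → Computable t (σ i) (⟦ x ⟧ᵛ · ρ)

extend : ∀ {Γ σ ρ t N y} → ComputableEnv Γ σ ρ → Computable t N y →
         ComputableEnv (t ∷ Γ) (N • σ) (ρ , y)
extend cσ cN here      = cN
extend cσ cN (there x) = cσ x

computable-num : ∀ n → Computable nat (num n) (e n)
computable-num n = lift (unit≤ n (Prob^∞-num n))

adequacy : ∀ {Γ M t} (d : Γ ⊢ M ⦂ t) {σ ρ} → ComputableEnv Γ σ ρ →
           Computable t (substitute σ M) (⟦ d ⟧ · ρ)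
adequacy (⊢var x) cσ = cσ x
adequacy (⊢lam {u = u} {M = M} d) {σ} {ρ} cσ N y cN =
  computable-expansion u refl
    (subst (λ M → Computable u M (⟦ d ⟧ · (ρ , y))) (sym (substitute-lift-[] σ M N))
      (adequacy d (extend cσ cN)))
adequacy (⊢app d d′) cσ = adequacy d cσ _ _ (adequacy d′ cσ)
adequacy (⊢fix {t = t} {M} d) {σ} {ρ} cσ = computable-⨆ t _ _ iterate-computable
  where
  iterate-computable : ∀ k → Computable t (fix (substitute σ M))
                                (Domain.iterate ⟦ t ⟧ᵀ k · (⟦ d ⟧ · ρ))
  iterate-computable zero    = computable-⊥ t
  -- `fix M` steps to `M` applied to `fix M`, matching one more application of the denotation of `M`
  -- to the previous iterate.
  iterate-computable (suc k) =
    computable-expansion t refl (adequacy d cσ _ _ (iterate-computable k))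
adequacy ⊢num cσ = computable-num _
adequacy (⊢succ {M = M} d) {σ} cσ = lift λ where
  zero    → 0≤ _
  -- Only the summand `i = n` for the context `succ` is kept: `succ (num n)` reaches `num (suc n)`
  -- with probability 1. The sum has length `suc n` so as to include that index.
  (suc n) → ≤-trans (lower (adequacy d cσ) n)
    (≤-trans (≤-trans (*-identityʳ-≥ _) (*-mono ≤-refl
      (≤-trans (Prob^∞-num (suc n)) (Prob^∞-expansion {succ (num n)} refl (suc n)))))
    (≤-trans (∑<-term (ℕₚ.n<1+n n)
      (λ i → Prob^∞ (substitute σ M) i * Prob^∞ (succ (num i)) (suc n)))
    (Prob^∞-evaluation evaluation-succ (suc n) (substitute σ M) (suc n))))
adequacy (⊢coin {κ = κ}) cσ = lift λ n →
  ≤-trans (+-mono (*-mono ≤-refl (lower (computable-num 0) n))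
                  (≤-trans (*-mono ≤-refl (lower (computable-num 1) n)) (≤-+ˡ _ 0ℝ)))
          (Prob^∞-successors (coin κ) n)
adequacy (⊢ifz {t = t} {M} {P} {Q} d p q) {σ} {ρ} cσ =
  -- The conditional denotes a supremum of partial sums; each is computable because branch `i` is
  -- the contractum of `ifz (num i) P′ Q′`.
  computable-⨆ t _ _
    (computable-partial t (evaluation-ifz P′ Q′) (adequacy d cσ) branch-computable)
  where
  P′ Q′ : Term
  P′ = substitute σ P
  Q′ = substitute (liftˢ σ) Q
  branch-computable : ∀ i → Computable t (ifz (num i) P′ Q′) (branches ⟦ p ⟧ ⟦ q ⟧ i · ρ)
  branch-computable zero    = computable-expansion t refl (adequacy p cσ)
  branch-computable (suc i) = computable-expansion t refl
    (subst (λ M → Computable t M (⟦ q ⟧ · (ρ , e i))) (sym (substitute-lift-[] σ Q (num i)))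
      (adequacy q (extend cσ (computable-num i))))

entry≤Prob^∞ : ∀ {M} (d : [] ⊢ M ⦂ nat) n → entry d n ≤ Prob^∞ M n
entry≤Prob^∞ {M} d n = subst (λ M → entry d n ≤ Prob^∞ M n) (substitute-var (λ _ → refl) M)
  -- The identity substitution is a computable environment vacuously, the context being empty.
  (lower (adequacy d {var} λ ()) n)

-- Soundness

infix 4 Below
Below : ∀ t → ∣ ⟨⟨ t ⟩⟩ ∣ → ∣ ⟨⟨ t ⟩⟩ ∣ → Set₁
Below t = DCPO._⊑_ ⟨⟨ t ⟩⟩

syntax Below t x y = x ⊑⟨ t ⟩ y

⊑-refl : ∀ t x → x ⊑⟨ t ⟩ x
⊑-refl t x = DCPO.⊑-refl ⟨⟨ t ⟩⟩ {x}

-- Renaming and substitution in the semantics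

Renaming : (ℕ → ℕ) → Context → Context → Set
Renaming ξ Γ Δ = ∀ {i t} → Γ ∋ i ⦂ t → Δ ∋ ξ i ⦂ t

⊢liftʳ : ∀ {ξ Γ Δ t} → Renaming ξ Γ Δ → Renaming (liftʳ ξ) (t ∷ Γ) (t ∷ Δ)
⊢liftʳ r here      = here
⊢liftʳ r (there x) = there (r x)

⊢rename : ∀ {ξ Γ Δ M t} → Renaming ξ Γ Δ → Γ ⊢ M ⦂ t → Δ ⊢ rename ξ M ⦂ t
⊢rename r (⊢var x)     = ⊢var (r x)
⊢rename r (⊢lam d)     = ⊢lam (⊢rename (⊢liftʳ r) d)
⊢rename r (⊢app d d′)  = ⊢app (⊢rename r d) (⊢rename r d′)
⊢rename r (⊢fix d)     = ⊢fix (⊢rename r d)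
⊢rename r ⊢num         = ⊢num
⊢rename r (⊢succ d)    = ⊢succ (⊢rename r d)
⊢rename r ⊢coin        = ⊢coin
⊢rename r (⊢ifz d p q) = ⊢ifz (⊢rename r d) (⊢rename r p) (⊢rename (⊢liftʳ r) q)

RenamingBelow : ∀ {ξ Γ Δ} → Renaming ξ Γ Δ → ∣ ⟦ Δ ⟧ᶜ ∣ → ∣ ⟦ Γ ⟧ᶜ ∣ → Set₁
RenamingBelow {Γ = Γ} r δ γ = ∀ {i t} (x : Γ ∋ i ⦂ t) → ⟦ r x ⟧ᵛ · δ ⊑⟨ t ⟩ ⟦ x ⟧ᵛ · γ

liftʳ-below : ∀ {ξ Γ Δ t} (r : Renaming ξ Γ Δ) {δ γ} → RenamingBelow r δ γ →
              ∀ y → RenamingBelow (⊢liftʳ {t = t} r) (δ , y) (γ , y)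
liftʳ-below {t = t} r r⊑ y here      = ⊑-refl t y
liftʳ-below         r r⊑ y (there x) = r⊑ x

-- Inequalities suffice throughout, because every construct is monotone.
⟦rename⟧ : ∀ {ξ Γ Δ M t} (r : Renaming ξ Γ Δ) {δ γ} → RenamingBelow r δ γ → (d : Γ ⊢ M ⦂ t) →
           ⟦ ⊢rename r d ⟧ · δ ⊑⟨ t ⟩ ⟦ d ⟧ · γ
⟦rename⟧ r r⊑ (⊢var x) = r⊑ x
⟦rename⟧ r r⊑ (⊢lam d) = λ y → ⟦rename⟧ (⊢liftʳ r) (liftʳ-below r r⊑ y) d
⟦rename⟧ r {δ} {γ} r⊑ (⊢app {t = t} {u} d d′) =
  mono (applyᶜ {⟨⟨ t ⟩⟩} {⟨⟨ u ⟩⟩}) {⟦ ⊢rename r d ⟧ · δ , _} {⟦ d ⟧ · γ , _}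
    (⟦rename⟧ r r⊑ d , ⟦rename⟧ r r⊑ d′)
⟦rename⟧ r r⊑ (⊢fix {t = t} d) = mono (Domain.fixpoint ⟦ t ⟧ᵀ) (⟦rename⟧ r r⊑ d)
⟦rename⟧ r r⊑ (⊢num {n = n}) = ⊑-refl nat (e n)
⟦rename⟧ r {δ} {γ} r⊑ (⊢succ d) =
  mono succᶜ {⟦ ⊢rename r d ⟧ · δ} {⟦ d ⟧ · γ} (⟦rename⟧ r r⊑ d)
⟦rename⟧ r r⊑ (⊢coin {κ = κ}) = ⊑-refl nat (coinᴰ κ)
⟦rename⟧ r r⊑ (⊢ifz {t = t} d p q) = mono (Domain.countable-sum ⟦ t ⟧ᵀ)
  ( ⟦rename⟧ r r⊑ d
  , λ { zero → ⟦rename⟧ r r⊑ p ; (suc i) → ⟦rename⟧ (⊢liftʳ r) (liftʳ-below r r⊑ (e i)) q })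

Substitution : (ℕ → Term) → Context → Context → Set
Substitution σ Γ Δ = ∀ {i t} → Γ ∋ i ⦂ t → Δ ⊢ σ i ⦂ t

⊢liftˢ : ∀ {σ Γ Δ t} → Substitution σ Γ Δ → Substitution (liftˢ σ) (t ∷ Γ) (t ∷ Δ)
⊢liftˢ s here      = ⊢var here
⊢liftˢ s (there x) = ⊢rename there (s x)

⊢substitute : ∀ {σ Γ Δ M t} → Substitution σ Γ Δ → Γ ⊢ M ⦂ t → Δ ⊢ substitute σ M ⦂ t
⊢substitute s (⊢var x)     = s x
⊢substitute s (⊢lam d)     = ⊢lam (⊢substitute (⊢liftˢ s) d)
⊢substitute s (⊢app d d′)  = ⊢app (⊢substitute s d) (⊢substitute s d′)
⊢substitute s (⊢fix d)     = ⊢fix (⊢substitute s d)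
⊢substitute s ⊢num         = ⊢num
⊢substitute s (⊢succ d)    = ⊢succ (⊢substitute s d)
⊢substitute s ⊢coin        = ⊢coin
⊢substitute s (⊢ifz d p q) = ⊢ifz (⊢substitute s d) (⊢substitute s p) (⊢substitute (⊢liftˢ s) q)

SubstitutionBelow : ∀ {σ Γ Δ} → Substitution σ Γ Δ → ∣ ⟦ Δ ⟧ᶜ ∣ → ∣ ⟦ Γ ⟧ᶜ ∣ → Set₁
SubstitutionBelow {Γ = Γ} s δ γ = ∀ {i t} (x : Γ ∋ i ⦂ t) → ⟦ s x ⟧ · δ ⊑⟨ t ⟩ ⟦ x ⟧ᵛ · γ

liftˢ-below : ∀ {σ Γ Δ t} (s : Substitution σ Γ Δ) {δ γ} → SubstitutionBelow s δ γ →
              ∀ y → SubstitutionBelow (⊢liftˢ {t = t} s) (δ , y) (γ , y)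
liftˢ-below {t = t} s s⊑ y here = ⊑-refl t y
-- The weakened term reads only `δ`, the part of the environment below the new entry `y`.
liftˢ-below s {δ} s⊑ y (there {t = t} x) = DCPO.⊑-trans ⟨⟨ t ⟩⟩
  (⟦rename⟧ there (λ {i} {u} z → ⊑-refl u (⟦ z ⟧ᵛ · δ)) (s x)) (s⊑ x)

⟦substitute⟧ : ∀ {σ Γ Δ M t} (s : Substitution σ Γ Δ) {δ γ} → SubstitutionBelow s δ γ →
               (d : Γ ⊢ M ⦂ t) → ⟦ ⊢substitute s d ⟧ · δ ⊑⟨ t ⟩ ⟦ d ⟧ · γ
⟦substitute⟧ s s⊑ (⊢var x) = s⊑ x
⟦substitute⟧ s s⊑ (⊢lam d) = λ y → ⟦substitute⟧ (⊢liftˢ s) (liftˢ-below s s⊑ y) d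
⟦substitute⟧ s {δ} {γ} s⊑ (⊢app {t = t} {u} d d′) =
  mono (applyᶜ {⟨⟨ t ⟩⟩} {⟨⟨ u ⟩⟩}) {⟦ ⊢substitute s d ⟧ · δ , _} {⟦ d ⟧ · γ , _}
    (⟦substitute⟧ s s⊑ d , ⟦substitute⟧ s s⊑ d′)
⟦substitute⟧ s s⊑ (⊢fix {t = t} d) = mono (Domain.fixpoint ⟦ t ⟧ᵀ) (⟦substitute⟧ s s⊑ d)
⟦substitute⟧ s s⊑ (⊢num {n = n}) = ⊑-refl nat (e n)
⟦substitute⟧ s {δ} {γ} s⊑ (⊢succ d) =
  mono succᶜ {⟦ ⊢substitute s d ⟧ · δ} {⟦ d ⟧ · γ} (⟦substitute⟧ s s⊑ d)
⟦substitute⟧ s s⊑ (⊢coin {κ = κ}) = ⊑-refl nat (coinᴰ κ)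
⟦substitute⟧ s s⊑ (⊢ifz {t = t} d p q) = mono (Domain.countable-sum ⟦ t ⟧ᵀ)
  ( ⟦substitute⟧ s s⊑ d
  , λ { zero    → ⟦substitute⟧ s s⊑ p
      ; (suc i) → ⟦substitute⟧ (⊢liftˢ s) (liftˢ-below s s⊑ (e i)) q })

⊢instantiate : ∀ {Γ N t} → Γ ⊢ N ⦂ t → Substitution (instantiate N) (t ∷ Γ) Γ
⊢instantiate d here      = d
⊢instantiate d (there x) = ⊢var x

⊢[] : ∀ {Γ M N t u} → t ∷ Γ ⊢ M ⦂ u → Γ ⊢ N ⦂ t → Γ ⊢ M [ N ] ⦂ u
⊢[] d d′ = ⊢substitute (⊢instantiate d′) d

⟦[]⟧ : ∀ {Γ M N t u} (d : t ∷ Γ ⊢ M ⦂ u) (d′ : Γ ⊢ N ⦂ t) {γ} →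
       ⟦ ⊢[] d d′ ⟧ · γ ⊑⟨ u ⟩ ⟦ d ⟧ · (γ , ⟦ d′ ⟧ · γ)
⟦[]⟧ {Γ} {t = t} d d′ {γ} = ⟦substitute⟧ (⊢instantiate d′) below d
  where
  below : SubstitutionBelow (⊢instantiate d′) γ (γ , ⟦ d′ ⟧ · γ)
  below here              = ⊑-refl t (⟦ d′ ⟧ · γ)
  below (there {t = u} x) = ⊑-refl u (⟦ x ⟧ᵛ · γ)

-- Elements of higher type are compared with subconvex sums after application
-- to a stack of arguments, which leaves only inequalities between reals.
Stack : Type → Set₁
Stack nat     = ⊤
Stack (t ⇾ u) = ∣ ⟨⟨ t ⟩⟩ ∣ × Stack u

observe : ∀ t → Stack t → ∣ ⟨⟨ t ⟩⟩ ∣ → ℕ → ℝ⁺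
observe nat     _       φ n = prob φ n
observe (t ⇾ u) (y , s) f n = observe u s (f · y) n

observe-mono : ∀ t s {x y} → x ⊑⟨ t ⟩ y → ∀ n → observe t s x n ≤ observe t s y n
observe-mono nat     s       (lift x≤y) = x≤y
observe-mono (t ⇾ u) (y , s) f⊑g        = observe-mono u s (f⊑g y)

observe-⨆ : ∀ t s {I : Set} (α : I → ∣ ⟨⟨ t ⟩⟩ ∣) d n →
            observe t s (DCPO.⨆ ⟨⟨ t ⟩⟩ α d) n ≤ sup (element d) (λ i → observe t s (α i) n)
observe-⨆ nat     s       α d n = ≤-refl
observe-⨆ (t ⇾ u) (y , s) α d n = observe-⨆ u s (λ i → α i · y) _ n

observe-partial : ∀ t s v x k n → observe t s (Domain.partial ⟦ t ⟧ᵀ k · (v , x)) n ≡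
                                  ∑< k (λ i → prob v i * observe t s (x i) n)
observe-partial nat     s       v x k n = refl
observe-partial (t ⇾ u) (y , s) v x k n = observe-partial u s v (λ i → x i · y) k n

observe-countable-sum-≤ : ∀ t s v x n →
  observe t s (Domain.countable-sum ⟦ t ⟧ᵀ · (v , x)) n ≤
  sup 0 (λ k → ∑< k (λ i → prob v i * observe t s (x i) n))
observe-countable-sum-≤ t s v x n = ≤-trans (observe-⨆ t s _ _ n)
  (sup-least _ λ k → ≤-trans (≤-reflexive (observe-partial t s v x k n))
    (sup-upper (λ k → ∑< k (λ i → prob v i * observe t s (x i) n)) k))

observe-countable-sum-≥ : ∀ t s v x n k →
  ∑< k (λ i → prob v i * observe t s (x i) n) ≤
  observe t s (Domain.countable-sum ⟦ t ⟧ᵀ · (v , x)) n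
observe-countable-sum-≥ t s v x n k =
  ≤-trans (≤-reflexive (sym (observe-partial t s v x k n)))
    (observe-mono t s (DCPO.⨆-upper ((Distr ⊗ Seq ⟨⟨ t ⟩⟩) ⇒ ⟨⟨ t ⟩⟩) T.partial
      (chain-directed ((Distr ⊗ Seq ⟨⟨ t ⟩⟩) ⇒ ⟨⟨ t ⟩⟩) T.partial T.partial-grow) k (v , x)) n)
  where module T = Domain ⟦ t ⟧ᵀ

-- `e j` has weight 1 at `j`, so the summand at `j` alone suffices; this is the semantic side of a
-- conditional on a numeral.
observe-branch : ∀ t s x j n →
  observe t s (x j) n ≤ observe t s (Domain.countable-sum ⟦ t ⟧ᵀ · (e j , x)) n
observe-branch t s x j n = ≤-trans
  (≤-trans (*-identityˡ-≥ _) (*-mono (1≤unit j) ≤-refl))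
  (≤-trans (∑<-term (ℕₚ.n<1+n j) (λ i → unit j i * observe t s (x i) n))
           (observe-countable-sum-≥ t s (e j) x n (suc j)))

-- Continuity moves `f` inside the supremum of the iterates, where it sends iterate `k` to iterate
-- `suc k`.
fixpoint-unfold : ∀ t f → f · (Domain.fixpoint ⟦ t ⟧ᵀ · f) ⊑⟨ t ⟩ Domain.fixpoint ⟦ t ⟧ᵀ · f
fixpoint-unfold t f = DCPO.⊑-trans ⟨⟨ t ⟩⟩ (continuous f _ _)
  (DCPO.⨆-least ⟨⟨ t ⟩⟩ _ _ λ k →
    DCPO.⨆-upper (⟨⟨ t ⇾ t ⟩⟩ ⇒ ⟨⟨ t ⟩⟩) T.iterate
      (chain-directed ((T.dcpo ⇒ T.dcpo) ⇒ T.dcpo) T.iterate T.iterate-grow) (suc k) f)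
  where module T = Domain ⟦ t ⟧ᵀ

-- Typed reduction and its soundness

Typed : Type → Set
Typed t = ∃ λ M → [] ⊢ M ⦂ t

erase : ∀ {t} → List (ℚ𝕀 × Typed t) → Outcomes
erase = map (map₂ proj₁)

plug : ∀ {t u} (C : Term → Term) → (∀ {M} → [] ⊢ M ⦂ t → [] ⊢ C M ⦂ u) → Typed t → Typed u
plug C ⊢C (M , d) = C M , ⊢C d

infix 2 _⇝_
-- Relates a derivation to the weighted list of its typed reducts, so that subject reduction is
-- built in and each reduct comes with a denotation.
data _⇝_ : ∀ {M t} → [] ⊢ M ⦂ t → List (ℚ𝕀 × Typed t) → Set where
  coin   : ∀ {κ} → ⊢coin {κ = κ} ⇝ (κ , num 0 , ⊢num) ∷ (1- κ , num 1 , ⊢num) ∷ []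
  unfold : ∀ {t M} {d : [] ⊢ M ⦂ t ⇾ t} → ⊢fix d ⇝ (1𝕀 , app M (fix M) , ⊢app d (⊢fix d)) ∷ []
  succ-β : ∀ {n} → ⊢succ (⊢num {n = n}) ⇝ (1𝕀 , num (suc n) , ⊢num) ∷ []
  lam-β  : ∀ {t u M N} {d : t ∷ [] ⊢ M ⦂ u} {d′ : [] ⊢ N ⦂ t} →
           ⊢app (⊢lam d) d′ ⇝ (1𝕀 , M [ N ] , ⊢[] d d′) ∷ []
  ifz₀   : ∀ {t P Q} {p : [] ⊢ P ⦂ t} {q : nat ∷ [] ⊢ Q ⦂ t} →
           ⊢ifz (⊢num {n = 0}) p q ⇝ (1𝕀 , P , p) ∷ []
  ifz₊   : ∀ {n t P Q} {p : [] ⊢ P ⦂ t} {q : nat ∷ [] ⊢ Q ⦂ t} →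
           ⊢ifz (⊢num {n = suc n}) p q ⇝ (1𝕀 , Q [ num n ] , ⊢[] q ⊢num) ∷ []
  succ-ξ : ∀ {M ws} {d : [] ⊢ M ⦂ nat} → d ⇝ ws →
           ⊢succ d ⇝ map (map₂ (plug succ ⊢succ)) ws
  app-ξ  : ∀ {t u M N ws} {d : [] ⊢ M ⦂ t ⇾ u} {d′ : [] ⊢ N ⦂ t} → d ⇝ ws →
           ⊢app d d′ ⇝ map (map₂ (plug (λ M → app M N) λ d → ⊢app d d′)) ws
  ifz-ξ  : ∀ {M t P Q ws} {d : [] ⊢ M ⦂ nat} {p : [] ⊢ P ⦂ t} {q : nat ∷ [] ⊢ Q ⦂ t} → d ⇝ ws →
           ⊢ifz d p q ⇝ map (map₂ (plug (λ M → ifz M P Q) λ d → ⊢ifz d p q)) ws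

-- A nonempty list in `step` ensures that `orStay` returns the outcomes unchanged and that
-- `Evaluation` can be applied.
data Progress : ∀ {M t} → [] ⊢ M ⦂ t → Set where
  numeral     : ∀ n → Progress (⊢num {n = n})
  abstraction : ∀ {t u M} (d : t ∷ [] ⊢ M ⦂ u) → Progress (⊢lam d)
  step        : ∀ {M t} {d : [] ⊢ M ⦂ t} {ws} w → d ⇝ w ∷ ws →
                outcomes M ≡ erase (w ∷ ws) → Progress d

step-ξ : ∀ {t u} M w ws (C : Term → Term) → Evaluation C →
         (⊢C : ∀ {N} → [] ⊢ N ⦂ t → [] ⊢ C N ⦂ u) →
         outcomes M ≡ erase (w ∷ ws) →
         outcomes (C M) ≡ erase (map (map₂ (plug C ⊢C)) (w ∷ ws))
step-ξ M w ws C eval ⊢C M⇝ = trans (eval M M⇝)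
  -- Erasing after plugging and plugging after erasing fuse to definitionally equal maps.
  (trans (cong (map (map₂ C)) M⇝) (trans (sym (map-∘ (w ∷ ws))) (map-∘ (w ∷ ws))))

progress : ∀ {M t} (d : [] ⊢ M ⦂ t) → Progress d
progress (⊢lam d) = abstraction d
progress ⊢num     = numeral _
progress ⊢coin    = step _ coin refl
progress (⊢fix d) = step _ unfold refl
progress (⊢succ {M = M} d) with progress d
... | numeral n    = step _ succ-β refl
... | step {ws = ws} w d⇝ eq = step _ (succ-ξ d⇝)
  (step-ξ M w ws succ evaluation-succ ⊢succ eq)
progress (⊢app {M = M} {N} d d′) with progress d
... | abstraction d = step _ lam-β refl
... | step {ws = ws} w d⇝ eq = step _ (app-ξ d⇝)
  (step-ξ M w ws (λ M → app M N) (evaluation-app N evaluation-hole) (λ d → ⊢app d d′) eq)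
progress (⊢ifz {M = M} {P} {Q} d p q) with progress d
... | numeral zero    = step _ ifz₀ refl
... | numeral (suc n) = step _ ifz₊ refl
... | step {ws = ws} w d⇝ eq = step _ (ifz-ξ d⇝)
  (step-ξ M w ws (λ M → ifz M P Q) (evaluation-ifz P Q) (λ d → ⊢ifz d p q) eq)

-- The semantics is in fact invariant under reduction; this is the half that
-- bounds the probabilities of reduction.
⇝-sound : ∀ {M t} {d : [] ⊢ M ⦂ t} {ws} → d ⇝ ws → ∀ s n →
          expect ws (λ (N , d′) → observe t s (⟦ d′ ⟧ · tt) n) ≤ observe t s (⟦ d ⟧ · tt) n
⇝-sound coin s n = +-mono ≤-refl (+-identityʳ-≤ ≤-refl)
⇝-sound (unfold {t} {d = d}) s n = ≤-trans 1*x+0≤x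
  (observe-mono t s (fixpoint-unfold t (⟦ d ⟧ · tt)) n)
-- Once the index is split, the shift of `unit` at a numeral and `unit` at its successor agree by
-- computation.
⇝-sound succ-β s zero = ≤-trans 1*x+0≤x ≤-refl
⇝-sound succ-β s (suc n) = ≤-trans 1*x+0≤x ≤-refl
⇝-sound (lam-β {u = u} {d = d} {d′}) s n = ≤-trans 1*x+0≤x
  (observe-mono u s (⟦[]⟧ d d′) n)
⇝-sound (ifz₀ {t} {p = p} {q}) s n = ≤-trans 1*x+0≤x
  (observe-branch t s (λ i → branches ⟦ p ⟧ ⟦ q ⟧ i · tt) 0 n)
⇝-sound (ifz₊ {j} {t} {p = p} {q}) s n = ≤-trans 1*x+0≤x
  (≤-trans (observe-mono t s (⟦[]⟧ q ⊢num) n)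
    (observe-branch t s (λ i → branches ⟦ p ⟧ ⟦ q ⟧ i · tt) (suc j) n))
⇝-sound (succ-ξ {ws = ws} d⇝) s zero =
  ≤-trans (≤-reflexive (expect-map _ ws _)) (expect-zero ws)
⇝-sound (succ-ξ {ws = ws} d⇝) s (suc n) =
  ≤-trans (≤-reflexive (expect-map _ ws _)) (⇝-sound d⇝ s n)
-- The denotation of the argument is pushed onto the stack at which the function is observed.
⇝-sound (app-ξ {ws = ws} {d′ = d′} d⇝) s n =
  ≤-trans (≤-reflexive (expect-map _ ws _)) (⇝-sound d⇝ (⟦ d′ ⟧ · tt , s) n)
-- The expectation is moved through the supremum and the finite sums, and the branch observations
-- `o i` are factored out; what remains is the induction hypothesis for the scrutinee at each entry.
⇝-sound (ifz-ξ {t = t} {ws = ws} {d} {p} {q} d⇝) s n =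
  ≤-trans (≤-reflexive (expect-map _ ws _))
  (≤-trans (expect-mono ws λ (N , d′) → observe-countable-sum-≤ t s (⟦ d′ ⟧ · tt) x n)
  (≤-trans (expect-sup ws (λ (N , d′) k → ∑< k (λ i → prob (⟦ d′ ⟧ · tt) i * o i))
    λ k l → k ℕ.⊔ l
      , (λ _ → ∑<-extend (ℕₚ.≤⇒≤′ (ℕₚ.m≤m⊔n k l)) _)
      , (λ _ → ∑<-extend (ℕₚ.≤⇒≤′ (ℕₚ.m≤n⊔m k l)) _))
  (sup-least _ λ k →
    ≤-trans (expect-∑<-≤ ws k (λ (N , d′) i → prob (⟦ d′ ⟧ · tt) i * o i))
    (≤-trans (∑<-mono k λ i → ≤-trans (expect-*-≥ ws (λ (N , d′) → prob (⟦ d′ ⟧ · tt) i) (o i))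
                                       (*-mono (⇝-sound d⇝ tt i) ≤-refl))
             (observe-countable-sum-≥ t s (⟦ d ⟧ · tt) x n k)))))
  where
  x : ℕ → ∣ ⟨⟨ t ⟩⟩ ∣
  x i = branches ⟦ p ⟧ ⟦ q ⟧ i · tt
  o : ℕ → ℝ⁺
  o i = observe t s (x i) n

Prob^≤entry : ∀ k {M} (d : [] ⊢ M ⦂ nat) n → (Prob ^ k) M (num n) ≤ entry d n
Prob^≤entry zero {M} d n with M ≟ num n
Prob^≤entry zero ⊢num n | yes refl = 1≤unit n
... | no _ = 0≤ _
Prob^≤entry (suc k) {M} d n with progress d
-- A numeral is its own successor with weight 1, so only the exponent drops.
... | numeral m = ≤-trans (Prob^-suc-≤ k (num m) (num n))
  (≤-trans (expect-dirac-≤ (num m) (λ M → (Prob ^ k) M (num n))) (Prob^≤entry k ⊢num n))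
... | step {ws = ws} w d⇝ eq = ≤-trans (Prob^-suc-≤ k M (num n))
  (≤-trans (≤-reflexive (trans (cong (λ os → expect (orStay M os) g) eq)
                             (expect-map proj₁ (w ∷ ws) g)))
  (≤-trans (expect-mono (w ∷ ws) λ (N , d′) → Prob^≤entry k d′ n)
           (⇝-sound d⇝ tt n)))
  where
  g : Term → ℝ⁺
  g N = (Prob ^ k) N (num n)

theorem4p4 : ∀ (M : Term) (⊢M : [] ⊢ M ⦂ nat) (n : ℕ) → entry ⊢M n ≈ Prob^∞ M n
theorem4p4 M ⊢M n =
  entry≤Prob^∞ ⊢M n , sup-least (λ k → (Prob ^ k) M (num n)) λ k → Prob^≤entry k ⊢M n
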